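{- Let $\mathbf d=(d_1,\dots,d_n)$ be a degree sequence of length $n$, let $m=\big(\sum_{i=1}^n d_i\big)/2$ and $m^*=\sum_{i=1}^n\min(d_i,n-d_i)$. Then for all pairs of realizations $G_1,G_2$ of $\mathbf d$, $$\mathbf{dist}_u(G_1,G_2)\le H'(G_1,G_2)\cdot\left(1-\frac{4}{3n}\right)\le m^*\left(\frac12-\frac{2}{3n}\right)\le m\left(1-\frac{4}{3n}\right).$$
   Context: All graphs are finite, simple and undirected, with labeled vertices $v_1,\dots,v_n$. A graph $G$ realizes a sequence $\mathbf d=(d_1,\dots,d_n)$ of positive integers if $d(v_i)=d_i$ for all $i$; a degree sequence is a sequence having a realization. Swap: if $a,b,c,d$ are four different vertices of $G$ with $(a,c),(b,d)\in E(G)$ and $(b,c),(a,d)\notin E(G)$, then a swap replaces $G$ by the graph $G'$ on the same vertex set with $E(G')=E(G)\setminus\{(a,c),(b,d)\}\cup\{(b,c),(a,d)\}$; $G'$ has the same degree sequence. $\mathbf{dist}_u(G_1,G_2)$ is the length (number of swaps) of a shortest sequence of swaps transforming $G_1$ into $G_2$. $H'(G_1,G_2)=|E(G_1)\,\Delta\, E(G_2)|/2$, where $\Delta$ is the symmetric difference. -}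

module Defs where

open import Data.Bool using (Bool; false; T; _xor_)
open import Data.Bool.Properties using (T?)
open import Data.Fin using (Fin; _<?_)
open import Data.Fin.Subset using (∣_∣)
open import Data.Integer using (+_)
open import Data.List using (List; []; _∷_; length; filter; cartesianProduct; allFin)
open import Data.List.Relation.Unary.Unique.Propositional using (Unique)
open import Data.Nat using (ℕ; zero; suc; _∸_; _⊓_; _≤_; _>_)
open import Data.Product using (_×_; _,_; ∃-syntax)
open import Data.Rational using (ℚ; _/_)
open import Data.Sum using (_⊎_)
open import Data.Vec using (Vec; lookup; map; sum; tabulate)
open import Function using (_⇔_)
open import Relation.Binary.PropositionalEquality using (_≡_)
open import Relation.Nullary using (¬_)

record Graph (n : ℕ) : Set where
  field
    adj        : Fin n → Fin n → Bool
    adj-sym    : ∀ u v → adj u v ≡ adj v u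
    adj-irrefl : ∀ v → adj v v ≡ false

  Adj : Fin n → Fin n → Set
  Adj u v = T (adj u v)

  degree : Fin n → ℕ
  degree v = ∣ tabulate (adj v) ∣

open Graph public using (Adj; degree)

-- Equality of labeled graphs; propositional equality of records would
-- need function extensionality.
_≈_ : ∀ {n} → Graph n → Graph n → Set
G ≈ H = ∀ u v → Graph.adj G u v ≡ Graph.adj H u v

Realizes : ∀ {n} → Graph n → Vec ℕ n → Set
Realizes G d = ∀ i → degree G i ≡ lookup d i

IsDegreeSequence : ∀ {n} → Vec ℕ n → Set
IsDegreeSequence {n} d = (∀ i → lookup d i > 0) × ∃[ G ] Realizes {n} G d

-- Equality {u , v} = {x , y} of unordered pairs.
SamePair : ∀ {n} → (u v x y : Fin n) → Set
SamePair u v x y = (u ≡ x × v ≡ y) ⊎ (u ≡ y × v ≡ x)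

record Swap {n : ℕ} (G G′ : Graph n) : Set where
  field
    a b c d  : Fin n
    distinct : Unique (a ∷ b ∷ c ∷ d ∷ [])
    ac∈E     : Adj G a c
    bd∈E     : Adj G b d
    bc∉E     : ¬ Adj G b c
    ad∉E     : ¬ Adj G a d
    -- E(G′) = (E(G) ∖ {(a,c),(b,d)}) ∪ {(b,c),(a,d)}
    E′-spec  : ∀ u v → Adj G′ u v ⇔
                 ((Adj G u v × ¬ (SamePair u v a c ⊎ SamePair u v b d))
                  ⊎ (SamePair u v b c ⊎ SamePair u v a d))

-- SwapSequence k G H: a sequence of exactly k swaps transforming G into H.
data SwapSequence {n : ℕ} : ℕ → Graph n → Graph n → Set where
  done : ∀ {G H} → G ≈ H → SwapSequence zero G H
  step : ∀ {k G G′ H} → Swap G G′ → SwapSequence k G′ H →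
         SwapSequence (suc k) G H

-- IsSwapDistance G H k says that dist_u(G , H) exists and equals k.
IsSwapDistance : ∀ {n} → Graph n → Graph n → ℕ → Set
IsSwapDistance G H k =
  SwapSequence k G H × (∀ j → SwapSequence j G H → k ≤ j)

-- Every unordered pair of distinct vertices is listed once, smaller label
-- first.
vertexPairs : ∀ n → List (Fin n × Fin n)
vertexPairs n =
  filter (λ (u , v) → u <? v) (cartesianProduct (allFin n) (allFin n))

symDiff : ∀ {n} → Graph n → Graph n → List (Fin n × Fin n)
symDiff {n} G H =
  filter (λ (u , v) → T? (Graph.adj G u v xor Graph.adj H u v)) (vertexPairs n)

H′ : ∀ {n} → Graph n → Graph n → ℚ
H′ G₁ G₂ = + length (symDiff G₁ G₂) / 2

m : ∀ {n} → Vec ℕ n → ℚ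
m d = + sum d / 2

-- The subtraction never truncates for a degree sequence, as dᵢ < n.
m* : ∀ {n} → Vec ℕ n → ℚ
m* {n} d = + sum (map (λ dᵢ → dᵢ ⊓ (n ∸ dᵢ)) d) / 1

{-# OPTIONS --safe #-}
-- The edges lying in only one of the two realizations form two colour classes of equal degree at
-- every vertex, so they contain alternating closed trails.  Take a shortest one, of length L.
-- Cutting it and reversing sections shows that a vertex occurs at most twice, at opposite
-- parities, and that repetitions are nested; hence the trail is a cactus of cycles of length at
-- least 3, which forces 2L < 3n.  Among the chords over three consecutive edges starting at
-- positions 0 and 1, one joins distinct vertices and is not an edge of the trail, and the swap
-- along it in one of the two realizations shortens the trail by 2 while removing two edges from
-- the symmetric difference (or four, when the chord closes an alternating 4-cycle).  Altogether
-- j - 1 swaps remove 2j edges for some j with 4j ≤ 3n, that is, at most 1 - 4/(3n) swaps per two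
-- removed edges.  Shortest trails are only found up to double negation; this suffices because
-- the existence of a swap sequence of given length is decidable.
module Submission where

open import Data.Bool using (Bool; true; false; not; if_then_else_; T; _∧_; _∨_; _xor_)
import Data.Bool.Properties as B
open import Data.Bool.Properties using (not-involutive; not-¬; ¬-not; T-≡; T?; ∧-zeroʳ; ∧-identityʳ; ∨-identityʳ; xor-comm)
open import Data.Empty using (⊥; ⊥-elim)
open import Data.Fin as F using (Fin; zero; suc; toℕ; combine)
import Data.Fin.Properties as F
open import Data.Fin.Subset using (∣_∣)
import Data.List as List
open import Data.List using (List; []; _∷_; _++_; length; filter; map; tabulate; allFin; cartesianProduct)
open import Data.List.Membership.Propositional.Properties using (∈-lookup)
import Data.List.Properties as List
open import Data.List.Relation.Unary.All as All using (All; []; _∷_)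
import Data.List.Relation.Unary.All.Properties as All
open import Data.List.Relation.Unary.AllPairs using ([]; _∷_; allPairs?)
open import Data.List.Relation.Unary.Unique.Propositional using (Unique)
import Data.List.Relation.Unary.Unique.Propositional.Properties as Unique
open import Data.Nat as ℕ using (ℕ; zero; suc; NonZero; z≤n; s≤s; s≤s⁻¹)
import Data.Nat.ListAction as ListAction
import Data.Nat.ListAction.Properties as ListAction
open import Data.Nat.Properties as ℕ using (m*n≢0; +-0-commutativeMonoid)
open import Data.Nat.Tactic.RingSolver using (solve-∀)
open import Algebra.Properties.CommutativeMonoid.Sum +-0-commutativeMonoid using (sum; sum-cong-≗; sum-replicate-zero; ∑-distrib-+; ∑-comm)
open import Data.Product using (_×_; _,_; ∃-syntax; proj₁; proj₂)
open import Data.Product.Properties using (≡-dec)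
open import Data.Sum using (_⊎_; inj₁; inj₂; [_,_]′)
open import Data.Unit using (tt)
open import Data.Vec using (Vec; []; _∷_)
import Data.Vec as Vec
open import Function using (_⇔_; mk⇔; Equivalence)
open import Relation.Binary.Definitions using (tri<; tri≈; tri>)
open import Relation.Binary.PropositionalEquality
open import Relation.Nullary
open import Relation.Unary using (Decidable)
open import Defs

open Graph using (adj; adj-sym; adj-irrefl)
open Equivalence using (to; from)

-- The constant arises because 1 - 1/j, the ratio of j - 1 swaps to j pairs of removed edges, is at
-- most 1 - 4/(3n) exactly when 4j ≤ 3n. As every swap but the last shortens the circuit by 2 and
-- the last needs a circuit of length at least 4, 2j is at most the original length L, and 2L < 3n
-- does the rest. A vertex is stored with the colour by which it is left, and all structure of a
-- shortest circuit comes from two prohibitions on these states: none repeats, and no two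
-- repetitions of vertices interleave as a, b, a, b. The failures of the two candidate chords would
-- interleave in this way. A good chord may lie in neither realization or in both, which decides
-- where the swap is made. Hence both realizations move towards each other, and swaps of the second
-- are reversed and appended at the end. After a swap the shortened circuit need not be shortest for
-- the new pair, so minimality is arranged anew in each round, and only the bound of 2j by the
-- original length is carried along.

module SwapBound where

  open import Data.Nat using (_+_; _*_; _∸_; _⊓_; _≤_; _<_; _<?_)
  open import Data.Nat.Properties hiding (m*n≢0; +-0-commutativeMonoid)

  -- Alternating trails and circuits

  samePair-sym : ∀ {n} {u v x y : Fin n} → SamePair u v x y → SamePair x y u v
  samePair-sym (inj₁ (refl , refl)) = inj₁ (refl , refl)
  samePair-sym (inj₂ (refl , refl)) = inj₂ (refl , refl)

  samePair-flipˡ : ∀ {n} {u v x y : Fin n} → SamePair u v x y → SamePair v u x y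
  samePair-flipˡ (inj₁ (p , q)) = inj₂ (q , p)
  samePair-flipˡ (inj₂ (p , q)) = inj₁ (q , p)

  samePair-flipʳ : ∀ {n} {u v x y : Fin n} → SamePair u v x y → SamePair u v y x
  samePair-flipʳ (inj₁ p) = inj₂ p
  samePair-flipʳ (inj₂ p) = inj₁ p

  samePair-resp : ∀ {n} {u v v′ x y y′ : Fin n} → v ≡ v′ → y ≡ y′ → SamePair u v x y → SamePair u v′ x y′
  samePair-resp refl refl e = e

  -- The colour is that of the edge by which the walk leaves the vertex. In an alternating walk it
  -- records the parity of the position.
  State : ℕ → Set
  State n = Fin n × Bool

  vtx : ∀ {n} → State n → Fin n
  vtx = proj₁

  col : ∀ {n} → State n → Bool
  col = proj₂

  -- The same visit seen by the reversed walk, which leaves along the colour by which the original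
  -- walk arrived.
  flip : ∀ {n} → State n → State n
  flip (v , c) = v , not c

  flip-flip : ∀ {n} (x : State n) → flip (flip x) ≡ x
  flip-flip (v , c) = cong (v ,_) (not-involutive c)

  flip≢ : ∀ {n} {x : State n} → x ≢ flip x
  flip≢ {x = v , c} eq = not-¬ (sym (cong col eq)) refl

  flip-injective : ∀ {n} {x y : State n} → flip x ≡ flip y → x ≡ y
  flip-injective {x = x} {y} eq = trans (sym (flip-flip x)) (trans (cong flip eq) (flip-flip y))

  -- Two colours give a vertex two states. Where states do not repeat, a second visit is therefore
  -- the flip of the first, and there is no third.
  vtx≡⇒ : ∀ {n} {x y : State n} → vtx x ≡ vtx y → x ≢ y → y ≡ flip x
  vtx≡⇒ {x = v , c} {.v , c′} refl x≢y = cong (v ,_) (¬-not (λ c′≡c → x≢y (cong (v ,_) (sym c′≡c))))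

  EdgeColouring : ℕ → Set
  EdgeColouring n = Bool → Fin n → Fin n → Bool

  record IsEdgeColouring {n} (D : EdgeColouring n) : Set where
    field
      D-sym    : ∀ c u v → D c u v ≡ D c v u
      D-irrefl : ∀ c v → D c v v ≡ false
      D-excl   : ∀ c u v → D c u v ≡ true → D (not c) u v ≡ false

    D-pair : ∀ {c u v x y} → SamePair u v x y → D c u v ≡ D c x y
    D-pair {c} {u} {v} (inj₁ (refl , refl)) = refl
    D-pair {c} {u} {v} (inj₂ (refl , refl)) = D-sym c u v

    D-colour : ∀ {c c′ u v x y} → SamePair u v x y → D c u v ≡ true → D c′ x y ≡ true → c ≡ c′
    D-colour {false} {false} sp p q = refl
    D-colour {true}  {true}  sp p q = refl
    D-colour {false} {true} {x = x} {y} sp p q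
      with () ← trans (sym q) (D-excl false x y (trans (sym (D-pair sp)) p))
    D-colour {true} {false} {x = x} {y} sp p q
      with () ← trans (sym q) (D-excl true x y (trans (sym (D-pair sp)) p))

  -- A step along an edge of the colour recorded in its source alternates that colour, so
  -- alternating walks in the graph are walks of states.
  Step : ∀ {n} → EdgeColouring n → State n → State n → Set
  Step D x y = D (col x) (vtx x) (vtx y) ≡ true × col y ≡ not (col x)

  -- Edges are compared without orientation, so a trail cannot reuse an edge in the opposite
  -- direction either.
  Ends : ∀ {n} → (ℕ → State n) → ℕ → (ℕ → State n) → ℕ → Set
  Ends s i t j = SamePair (vtx (s i)) (vtx (s (suc i))) (vtx (t j)) (vtx (t (suc j)))

  -- Only the values of s at 0, …, L matter.
  record Trail {n} (D : EdgeColouring n) (L : ℕ) (s : ℕ → State n) : Set where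
    field
      steps  : ∀ {k} → k < L → Step D (s k) (s (suc k))
      unique : ∀ {i j} → i < L → j < L → Ends s i s j → i ≡ j

  -- Closing up in the colour as well makes the last and the first edge alternate; hence every
  -- circuit has even length.
  record Circuit {n} (D : EdgeColouring n) (L : ℕ) : Set where
    field
      state    : ℕ → State n
      trail    : Trail D L state
      positive : 0 < L
      closed   : state L ≡ state 0

  sub : ∀ {n D L s} a {q} → a + q ≤ L → Trail {n} D L s → Trail D q (λ k → s (a + k))
  sub {D = D} {s = s} a {q} le T = record
    { steps  = λ {k} k<q → subst (λ z → Step D (s (a + k)) (s z)) (sym (+-suc a k))
                 (Trail.steps T (<-≤-trans (+-monoʳ-< a k<q) le))
    ; unique = λ {i} {j} i<q j<q e → +-cancelˡ-≡ a i j
        (Trail.unique T (<-≤-trans (+-monoʳ-< a i<q) le) (<-≤-trans (+-monoʳ-< a j<q) le)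
          (samePair-resp (cong (λ z → vtx (s z)) (+-suc a i)) (cong (λ z → vtx (s z)) (+-suc a j)) e)) }

  glueStates : ∀ {n} → ℕ → (ℕ → State n) → (ℕ → State n) → ℕ → State n
  glueStates p s t k with k <? p
  ... | yes _ = s k
  ... | no  _ = t (k ∸ p)

  glueˡ : ∀ {n p k} {s t : ℕ → State n} → k < p → glueStates p s t k ≡ s k
  glueˡ {p = p} {k} k<p with k <? p
  ... | yes _ = refl
  ... | no ¬q = ⊥-elim (¬q k<p)

  glueʳ : ∀ {n} p k {s t : ℕ → State n} → glueStates p s t (p + k) ≡ t k
  glueʳ p k {t = t} with p + k <? p
  ... | yes q = ⊥-elim (m+n≮m p k q)
  ... | no _  = cong t (m+n∸m≡n p k)

  glueˡ-≤ : ∀ {n p k} {s t : ℕ → State n} → s p ≡ t 0 → k ≤ p → glueStates p s t k ≡ s k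
  glueˡ-≤ {p = p} {k} {s} {t} eq k≤p with m≤n⇒m<n∨m≡n k≤p
  ... | inj₁ k<p  = glueˡ k<p
  ... | inj₂ refl = trans (cong (glueStates p s t) (sym (+-identityʳ p)))
                          (trans (glueʳ p 0) (sym eq))

  data Split (p q : ℕ) : ℕ → Set where
    before : ∀ {k} → k < p → Split p q k
    after  : ∀ {k} → k < q → Split p q (p + k)

  split : ∀ p q {k} → k < p + q → Split p q k
  split p q {k} k<p+q with k <? p
  ... | yes k<p = before k<p
  ... | no  k≮p = subst (Split p q) (m+[n∸m]≡n (≮⇒≥ k≮p))
    (after (+-cancelˡ-< p (k ∸ p) q (subst (_< p + q) (sym (m+[n∸m]≡n (≮⇒≥ k≮p))) k<p+q)))

  glue : ∀ {n D p q s t} → Trail {n} D p s → Trail D q t → s p ≡ t 0 →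
         (∀ {i j} → i < p → j < q → ¬ Ends s i t j) →
         Trail D (p + q) (glueStates p s t)
  glue {n} {D} {p} {q} {s} {t} S T eq disj = record { steps = stp ; unique = unq }
    where
    g : ℕ → State n
    g = glueStates p s t
    g-after : ∀ k → g (suc (p + k)) ≡ t (suc k)
    g-after k = trans (cong g (sym (+-suc p k))) (glueʳ p (suc k))
    stp : ∀ {k} → k < p + q → Step D (g k) (g (suc k))
    stp k<p+q with split p q k<p+q
    ... | before k<p = subst₂ (Step D) (sym (glueˡ k<p)) (sym (glueˡ-≤ eq k<p)) (Trail.steps S k<p)
    ... | after {k} k<q = subst₂ (Step D) (sym (glueʳ p k)) (sym (g-after k)) (Trail.steps T k<q)
    ends : ∀ {i j x x′ y y′} → g i ≡ x → g (suc i) ≡ x′ → g j ≡ y → g (suc j) ≡ y′ → Ends g i g j →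
           SamePair (vtx x) (vtx x′) (vtx y) (vtx y′)
    ends refl refl refl refl e = e
    unq : ∀ {i j} → i < p + q → j < p + q → Ends g i g j → i ≡ j
    unq i< j< e with split p q i< | split p q j<
    ... | before i<p | before j<p = Trail.unique S i<p j<p
          (ends (glueˡ i<p) (glueˡ-≤ eq i<p) (glueˡ j<p) (glueˡ-≤ eq j<p) e)
    ... | before i<p | after {j} j<q = ⊥-elim (disj i<p j<q
          (ends (glueˡ i<p) (glueˡ-≤ eq i<p) (glueʳ p j) (g-after j) e))
    ... | after {i} i<q | before j<p = ⊥-elim (disj j<p i<q
          (samePair-sym (ends (glueʳ p i) (g-after i) (glueˡ j<p) (glueˡ-≤ eq j<p) e)))
    ... | after {i} i<q | after {j} j<q = cong (p +_) (Trail.unique T i<q j<q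
          (ends (glueʳ p i) (g-after i) (glueʳ p j) (g-after j) e))

  module _ {n} {D : EdgeColouring n} (isD : IsEdgeColouring D) where

    open IsEdgeColouring isD

    step-flip : ∀ {x y} → Step D x y → Step D (flip y) (flip x)
    step-flip {v , c} {w , d} (e , refl) =
      trans (cong (λ b → D b w v) (not-involutive c)) (trans (D-sym c w v) e) ,
      sym (not-involutive (not c))

    step-loop : ∀ {x y} → Step D x y → vtx x ≢ vtx y
    step-loop {v , c} (e , _) refl with () ← trans (sym e) (D-irrefl c v)

    rev : ∀ {q s} → Trail D q s → Trail D q (λ k → flip (s (q ∸ k)))
    rev {q} {s} T = record
      { steps  = λ {k} k<q → step-flip (subst (λ z → Step D (s (q ∸ suc k)) (s z)) (suc-∸ k<q)
                   (Trail.steps T (∸-< k<q)))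
      ; unique = λ {i} {j} i<q j<q e → suc-injective
          (∸-cancelˡ-≡ i<q j<q (Trail.unique T (∸-< i<q) (∸-< j<q)
            (samePair-resp (cong (λ z → vtx (s z)) (sym (suc-∸ i<q))) (cong (λ z → vtx (s z)) (sym (suc-∸ j<q)))
              (samePair-flipʳ (samePair-flipˡ e))))) }
      where
      suc-∸ : ∀ {k} → k < q → suc (q ∸ suc k) ≡ q ∸ k
      suc-∸ k<q = sym (+-∸-assoc 1 k<q)
      ∸-< : ∀ {k} → k < q → q ∸ suc k < q
      ∸-< {k} k<q = subst (_≤ q) (sym (suc-∸ k<q)) (m∸n≤m q k)

    -- Equality of the states, not only of the vertices, makes the section between the two positions
    -- alternate at the place where it closes.
    closeRepeat : ∀ {L s i j} → Trail D L s → i < j → j ≤ L → s i ≡ s j → Circuit D (j ∸ i)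
    closeRepeat {s = s} {i} {j} T i<j j≤L eq = record
      { state = _
      ; trail = sub i (subst (_≤ _) (sym (m+[n∸m]≡n (<⇒≤ i<j))) j≤L) T
      ; positive = m<n⇒0<n∸m i<j
      ; closed = trans (cong s (m+[n∸m]≡n (<⇒≤ i<j))) (trans (sym eq) (cong s (sym (+-identityʳ i)))) }

    -- The two sections a→b and c→d of the trail join the same two vertices; traversing the
    -- second one backwards closes up the first.
    closeCrossing : ∀ {L s} a p c q → Trail D L s → 0 < p → a + p ≤ c → c + q ≤ L →
                    s c ≡ flip (s a) → s (c + q) ≡ flip (s (a + p)) → Circuit D (p + q)
    closeCrossing {L} {s} a p c q T 0<p a+p≤c c+q≤L ca da = record
      { state = _
      ; trail = glue (sub a (≤-trans a+p≤c (≤-trans (m≤m+n c q) c+q≤L)) T)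
                     (rev (sub c c+q≤L T))
                     (trans (sym (flip-flip (s (a + p)))) (cong flip (sym da)))
                     disj
      ; positive = <-≤-trans 0<p (m≤m+n p q)
      ; closed = trans (glueʳ p q) (trans (cong (λ z → flip (s (c + z))) (n∸n≡0 q))
          (trans (cong (λ z → flip (s z)) (+-identityʳ c)) (trans (cong flip ca)
          (trans (flip-flip (s a)) (trans (cong s (sym (+-identityʳ a))) (sym (glueˡ 0<p)))))))
      }
      where
      suc-∸ : ∀ {k} → k < q → suc (q ∸ suc k) ≡ q ∸ k
      suc-∸ k<q = sym (+-∸-assoc 1 k<q)
      disj : ∀ {i j} → i < p → j < q → ¬ Ends (λ k → s (a + k)) i (λ k → flip (s (c + (q ∸ k)))) j
      disj {i} {j} i<p j<q e = <⇒≢ lt (Trail.unique T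
        (<-≤-trans lt (≤-trans (+-monoʳ-≤ c (m∸n≤m q (suc j))) c+q≤L))
        (<-≤-trans (+-monoʳ-< c (subst (_≤ q) (sym (suc-∸ j<q)) (m∸n≤m q j))) c+q≤L)
        (samePair-resp (cong (λ z → vtx (s z)) (+-suc a i))
          (cong (λ z → vtx (s z)) (trans (cong (c +_) (sym (suc-∸ j<q))) (+-suc c (q ∸ suc j))))
          (samePair-flipʳ e)))
        where
        lt : a + i < c + (q ∸ suc j)
        lt = <-≤-trans (+-monoʳ-< a i<p) (≤-trans a+p≤c (m≤m+n c _))

    -- Three consecutive edges of the circuit are replaced by the chord joining their ends.
    -- D′ is either D or what it becomes after a swap on these three edges and the chord.
    shortcut : ∀ {L s} {D′ : EdgeColouring n} p → Trail D L s → s L ≡ s 0 → 3 + p ≤ L → 3 < L →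
               (∀ {k} → k < L → k ≢ p → k ≢ suc p → k ≢ suc (suc p) → Step D′ (s k) (s (suc k))) →
               Step D′ (s p) (s (3 + p)) →
               (∀ {k} → k < L → ¬ SamePair (vtx (s k)) (vtx (s (suc k))) (vtx (s p)) (vtx (s (3 + p)))) →
               Circuit D′ (L ∸ 2)
    shortcut {L} {s} {D′} p T cl 3+p≤L 3<L old new notin = record
      { state = g ; trail = subst (λ z → Trail D′ z g) len tr
      ; positive = m<n⇒0<n∸m (<-trans (s≤s (s≤s (s≤s z≤n))) 3<L)
      ; closed = trans (trans (cong g (sym len)) (trans (glueʳ p (1 + r)) (trans (cong s tot) cl))) (sym start) }
      where
      r : ℕ
      r = L ∸ (3 + p)
      tot : 3 + p + r ≡ L
      tot = m+[n∸m]≡n 3+p≤L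
      len : p + (1 + r) ≡ L ∸ 2
      len = trans (+-suc p r) (cong (_∸ 2) tot)
      t : ℕ → State n
      t zero    = s p
      t (suc k) = s (3 + p + k)
      g : ℕ → State n
      g = glueStates p s t
      start : g 0 ≡ s 0
      start = glueˡ-≤ {p = p} {s = s} {t = t} refl z≤n
      next : ∀ k → vtx (s (3 + p + suc k)) ≡ vtx (s (suc (3 + p + k)))
      next k = cong (λ z → vtx (s z)) (+-suc (3 + p) k)
      3+p+k<L : ∀ {k} → k < r → 3 + p + k < L
      3+p+k<L k<r = subst (_ <_) tot (+-monoʳ-< (3 + p) k<r)
      st-t : ∀ {k} → k < 1 + r → Step D′ (t k) (t (suc k))
      st-t {zero} _ = subst (λ z → Step D′ (s p) (s z)) (sym (+-identityʳ (3 + p))) new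
      st-t {suc k} (s≤s k<r) = subst (λ z → Step D′ (s (3 + p + k)) (s z)) (sym (+-suc (3 + p) k))
        (old (3+p+k<L k<r)
          (>⇒≢ (s≤s (≤-trans (m≤m+n p k) (m≤n+m (p + k) 2))))
          (>⇒≢ (s≤s (s≤s (≤-trans (m≤m+n p k) (n≤1+n (p + k))))))
          (>⇒≢ (s≤s (s≤s (s≤s (m≤m+n p k))))))
      notin′ : ∀ {k} → k < L → ¬ SamePair (vtx (s k)) (vtx (s (suc k))) (vtx (s p)) (vtx (s (3 + p + 0)))
      notin′ k<L e = notin k<L (samePair-resp refl (cong (λ z → vtx (s z)) (+-identityʳ (3 + p))) e)
      un-t : ∀ {i j} → i < 1 + r → j < 1 + r → Ends t i t j → i ≡ j
      un-t {zero} {zero} _ _ _ = refl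
      un-t {zero} {suc j} _ (s≤s j<r) e = ⊥-elim (notin′ (3+p+k<L j<r) (samePair-resp (next j) refl (samePair-sym e)))
      un-t {suc i} {zero} (s≤s i<r) _ e = ⊥-elim (notin′ (3+p+k<L i<r) (samePair-resp (next i) refl e))
      un-t {suc i} {suc j} (s≤s i<r) (s≤s j<r) e = cong suc (+-cancelˡ-≡ (3 + p) i j
        (Trail.unique T (3+p+k<L i<r) (3+p+k<L j<r) (samePair-resp (next i) (next j) e)))
      <p⇒<L : ∀ {i} → i < p → i < L
      <p⇒<L i<p = <-≤-trans i<p (≤-trans (m≤n+m p 3) 3+p≤L)
      disj : ∀ {i j} → i < p → j < 1 + r → ¬ Ends s i t j
      disj {j = zero} i<p _ e = notin′ (<p⇒<L i<p) e
      disj {i} {suc j} i<p (s≤s j<r) e = <⇒≢ (<-≤-trans i<p (≤-trans (m≤n+m p 3) (m≤m+n (3 + p) j)))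
        (Trail.unique T (<p⇒<L i<p) (3+p+k<L j<r) (samePair-resp refl (next j) e))
      tr : Trail D′ (p + (1 + r)) g
      tr = glue
        (record { steps  = λ k<p → old (<p⇒<L k<p) (<⇒≢ k<p) (<⇒≢ (m<n⇒m<1+n k<p)) (<⇒≢ (m<n⇒m<1+n (m<n⇒m<1+n k<p)))
                ; unique = λ i< j< → Trail.unique T (<p⇒<L i<) (<p⇒<L j<) })
        (record { steps = st-t ; unique = un-t }) refl disj

  -- Circuits of minimal length

  unique⇒lookup-injective : ∀ {A : Set} {xs : List A} → Unique xs →
                            ∀ {i j} → List.lookup xs i ≡ List.lookup xs j → i ≡ j
  unique⇒lookup-injective (p ∷ u) {zero}  {zero}  eq = refl
  unique⇒lookup-injective {xs = _ ∷ xs} (p ∷ u) {zero}  {suc j} eq = ⊥-elim (All.lookup p (∈-lookup j) eq)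
  unique⇒lookup-injective {xs = _ ∷ xs} (p ∷ u) {suc i} {zero}  eq = ⊥-elim (All.lookup p (∈-lookup i) (sym eq))
  unique⇒lookup-injective (p ∷ u) {suc i} {suc j} eq = cong suc (unique⇒lookup-injective u eq)

  unique⇒length≤ : ∀ {n} {xs : List (Fin n)} → Unique xs → length xs ≤ n
  unique⇒length≤ u = F.injective⇒≤ (unique⇒lookup-injective u)

  module MinimalCircuit {n} {D : EdgeColouring n} (isD : IsEdgeColouring D) {L : ℕ} (s : ℕ → State n)
    (T : Trail D L s) (closed : s L ≡ s 0) (minimal : ∀ {L′} → L′ < L → ¬ Circuit D L′) where

    open IsEdgeColouring isD
    open Trail T

    -- The condition `j < i + L` rules out just the pair 0, L, at which the circuit closes.
    distinct : ∀ {i j} → i < j → j ≤ L → j < i + L → s i ≢ s j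
    distinct {i} {j} i<j j≤L j<i+L eq = minimal
      (subst (j ∸ i <_) (m+n∸m≡n i L) (∸-monoˡ-< j<i+L (<⇒≤ i<j)))
      (closeRepeat isD T i<j j≤L eq)

    distinct< : ∀ {i j} → i < j → j < L → s i ≢ s j
    distinct< {i} i<j j<L = distinct i<j (<⇒≤ j<L) (<-≤-trans j<L (m≤n+m L i))

    -- The circuit made of the sections from a to b and from c to d omits the nonempty section from
    -- b to c, so it would be shorter than L.
    noCrossing : ∀ {a b c d} → a < b → b < c → c ≤ d → d ≤ L → s c ≡ flip (s a) → s d ≢ flip (s b)
    noCrossing {a} {b} {c} {d} a<b b<c c≤d d≤L ca db = minimal short
      (closeCrossing isD a (b ∸ a) c (d ∸ c) T (m<n⇒0<n∸m a<b)
        (subst (_≤ c) (sym b≡) (<⇒≤ b<c)) (subst (_≤ L) (sym d≡) d≤L) ca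
        (subst₂ (λ y z → s y ≡ flip (s z)) (sym d≡) (sym b≡) db))
      where
      b≡ : a + (b ∸ a) ≡ b
      b≡ = m+[n∸m]≡n (<⇒≤ a<b)
      d≡ : c + (d ∸ c) ≡ d
      d≡ = m+[n∸m]≡n c≤d
      short : b ∸ a + (d ∸ c) < L
      short = <-≤-trans (+-monoˡ-< (d ∸ c) (≤-<-trans (m∸n≤m b a) b<c)) (subst (_≤ L) (sym d≡) d≤L)

    loop≢ : ∀ {k} → k < L → s (suc k) ≢ flip (s k)
    loop≢ k<L eq = step-loop isD (steps k<L) (sym (cong vtx eq))

    vtx-suc≢ : ∀ {k} → k < L → vtx (s k) ≢ vtx (s (suc k))
    vtx-suc≢ k<L = step-loop isD (steps k<L)

    col-2+ : ∀ {k} → suc k < L → col (s (suc (suc k))) ≡ col (s k)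
    col-2+ {k} k<L = trans (proj₂ (steps k<L))
      (trans (cong not (proj₂ (steps (<⇒≤ k<L)))) (not-involutive _))

    col-3+ : ∀ {k} → suc (suc k) < L → col (s (suc (suc (suc k)))) ≡ not (col (s k))
    col-3+ k<L = trans (proj₂ (steps k<L)) (cong not (col-2+ (<⇒≤ k<L)))

    -- Colours agree two positions apart, whereas a flip changes the colour.
    two≢ : ∀ {k} → suc k < L → s (suc (suc k)) ≢ flip (s k)
    two≢ k<L eq = not-¬ refl (trans (sym (col-2+ k<L)) (cong col eq))

    two≢′ : ∀ {k} → suc k < L → s k ≢ flip (s (suc (suc k)))
    two≢′ k<L eq = two≢ k<L (trans (sym (flip-flip _)) (cong flip (sym eq)))

    loop≢′ : ∀ {k} → k < L → s k ≢ flip (s (suc k))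
    loop≢′ k<L eq = loop≢ k<L (trans (sym (flip-flip _)) (cong flip (sym eq)))

    -- The chord joining positions p and p + 3 is degenerate, or it is itself an edge of the
    -- circuit, traversed in the opposite direction.
    BadChord : ℕ → Set
    BadChord p = s (3 + p) ≡ flip (s p) ⊎
                 ∃[ j ] (j < L × s j ≡ flip (s (3 + p)) × s (suc j) ≡ flip (s p))

    -- A bad chord makes positions flips of each other. In each combination of the two kinds of
    -- badness at 0 and at 1, either two such repetitions interleave or two neighbouring vertices
    -- coincide. The bounds `4<j` and `2<k` exclude the small positions for which the required order
    -- would fail.
    not-both-bad : 3 < L → BadChord 0 → ¬ BadChord 1
    not-both-bad 3<L = go
      where
      0<L : 0 < L
      0<L = ≤-trans (s≤s z≤n) 3<L
      1<L : 1 < L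
      1<L = ≤-trans (s≤s (s≤s z≤n)) 3<L
      2<L : 2 < L
      2<L = ≤-trans (s≤s (s≤s (s≤s z≤n))) 3<L
      4<j : ∀ j → s j ≡ flip (s 3) → s (suc j) ≡ flip (s 0) → 4 < j
      4<j 0 ej ej′ = ⊥-elim (loop≢ 0<L ej′)
      4<j 1 ej ej′ = ⊥-elim (two≢′ 2<L ej)
      4<j 2 ej ej′ = ⊥-elim (loop≢′ 2<L ej)
      4<j 3 ej ej′ = ⊥-elim (flip≢ ej)
      4<j 4 ej ej′ = ⊥-elim (loop≢ 3<L ej)
      4<j (suc (suc (suc (suc (suc j))))) _ _ = s≤s (s≤s (s≤s (s≤s (s≤s z≤n))))
      2<k : ∀ k → s (suc k) ≡ flip (s 1) → k ≢ 2 → 2 < k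
      2<k 0 ek′ k≢2 = ⊥-elim (flip≢ ek′)
      2<k 1 ek′ k≢2 = ⊥-elim (loop≢ 1<L ek′)
      2<k 2 ek′ k≢2 = ⊥-elim (k≢2 refl)
      2<k (suc (suc (suc k))) _ _ = s≤s (s≤s (s≤s z≤n))
      go : BadChord 0 → ¬ BadChord 1
      go (inj₁ e) (inj₁ e′) = noCrossing (s≤s z≤n) (s≤s (s≤s z≤n)) (n≤1+n 3) 3<L e e′
      go (inj₁ e) (inj₂ (k , k<L , ek , ek′)) =
        noCrossing (s≤s z≤n) (s≤s (s≤s z≤n)) (m≤n⇒m≤1+n (2<k k ek′ k≢2)) k<L e ek′
        where
        k≢2 : k ≢ 2
        k≢2 refl = vtx-suc≢ 0<L (cong vtx (flip-injective (trans (sym e) ek′)))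
      go (inj₂ (j , j<L , ej , ej′)) (inj₁ e) =
        noCrossing (s≤s (s≤s z≤n)) ≤-refl (<⇒≤ (4<j j ej ej′)) (<⇒≤ j<L) e ej
      go (inj₂ (j , j<L , ej , ej′)) (inj₂ (k , k<L , ek , ek′)) with <-cmp k j
      ... | tri> _ _ j<k = noCrossing (n<1+n 3) (4<j j ej ej′) (<⇒≤ j<k) (<⇒≤ k<L) ej ek
      ... | tri≈ _ refl _ = vtx-suc≢ 3<L (cong vtx (flip-injective (trans (sym ej) ek)))
      ... | tri< k<j _ _ = noCrossing (s≤s (s≤s z≤n)) (s≤s 2<k′) k<j (<⇒≤ j<L) ek′ ej
        where
        2<k′ : 2 < k
        2<k′ = 2<k k ek′ (λ { refl → two≢ 2<L ek′ })

    module Chord {p} (3+p≤L : 3 + p ≤ L) (3<L : 3 < L) (good : ¬ BadChord p) where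

      p<L : p < L
      p<L = ≤-trans (m≤n+m (suc p) 2) 3+p≤L
      p+1<L : suc p < L
      p+1<L = ≤-trans (m≤n+m (suc (suc p)) 1) 3+p≤L

      ends≢ : vtx (s p) ≢ vtx (s (3 + p))
      ends≢ eq = good (inj₁ (vtx≡⇒ eq (distinct (m≤n+m (suc p) 2) 3+p≤L
        (subst (3 + p <_) (+-comm L p) (+-monoˡ-< p 3<L)))))

      p≢p+2 : vtx (s p) ≢ vtx (s (2 + p))
      p≢p+2 eq = two≢ p+1<L (vtx≡⇒ eq (distinct< (m≤n+m (suc p) 1) 3+p≤L))

      p+1≢p+3 : vtx (s (1 + p)) ≢ vtx (s (3 + p))
      p+1≢p+3 eq = two≢ 3+p≤L (vtx≡⇒ eq (distinct (m≤n+m (2 + p) 1) 3+p≤L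
        (s≤s (subst (2 + p <_) (+-comm L p) (+-monoˡ-< p (<-trans (n<1+n 2) 3<L))))))

      -- The colour is forced, so the chord would be an edge of the circuit traversed forwards
      -- (a repeated state) or backwards (a bad chord).
      chord∉circuit : D (col (s p)) (vtx (s p)) (vtx (s (3 + p))) ≡ true →
                      ∀ {k} → k < L → ¬ SamePair (vtx (s k)) (vtx (s (suc k))) (vtx (s p)) (vtx (s (3 + p)))
      chord∉circuit isEdge {k} k<L e = go e
        where
        same : col (s k) ≡ col (s p)
        same = D-colour e (proj₁ (steps k<L)) isEdge
        col-k+1 : col (s (suc k)) ≡ not (col (s p))
        col-k+1 = trans (proj₂ (steps k<L)) (cong not same)
        go : ¬ SamePair (vtx (s k)) (vtx (s (suc k))) (vtx (s p)) (vtx (s (3 + p)))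
        go (inj₁ (eq , eq′)) with <-cmp k p
        ... | tri< k<p _ _ = distinct< k<p p<L (cong₂ _,_ eq same)
        ... | tri> _ _ p<k = distinct< p<k k<L (sym (cong₂ _,_ eq same))
        ... | tri≈ _ refl _ = p+1≢p+3 eq′
        go (inj₂ (eq , eq′)) = good (inj₂ (k , k<L ,
          cong₂ _,_ eq (trans same (trans (sym (not-involutive _)) (cong not (sym (col-3+ 3+p≤L))))) ,
          cong₂ _,_ eq′ col-k+1))

      -- Otherwise the chord could replace the three edges within `D` itself, without any swap, and
      -- the circuit of length L - 2 would contradict minimality.
      chord-colour : D (col (s p)) (vtx (s p)) (vtx (s (3 + p))) ≡ false
      chord-colour = ¬-not λ isEdge → minimal (∸-monoʳ-< {L} {2} {0} (s≤s z≤n) (≤-trans (n≤1+n 2) (<⇒≤ 3<L)))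
        (shortcut isD p T closed 3+p≤L 3<L (λ k<L _ _ _ → steps k<L)
          (isEdge , col-3+ 3+p≤L) (chord∉circuit isEdge))

    -- Lower bounds on the number of vertices met by a section of a minimal circuit

    record Span (a b : ℕ) (xs : List (Fin n)) : Set where
      constructor span
      field
        distinct-vertices : Unique xs
        located           : All (λ x → ∃[ i ] (a ≤ i × i < b × vtx (s i) ≡ x)) xs

    span-[] : ∀ {a b} → Span a b []
    span-[] = span [] []

    shift : ∀ {a a′ b b′} {xs} → a′ ≤ a → b ≤ b′ →
            All (λ x → ∃[ i ] (a ≤ i × i < b × vtx (s i) ≡ x)) xs →
            All (λ x → ∃[ i ] (a′ ≤ i × i < b′ × vtx (s i) ≡ x)) xs
    shift le le′ = All.map λ { (i , p , q , eq) → i , ≤-trans le p , <-≤-trans q le′ , eq }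

    span-∷ : ∀ {a b xs} → a < b → (∀ j → a < j → j < b → vtx (s a) ≢ vtx (s j)) →
             Span (suc a) b xs → Span a b (vtx (s a) ∷ xs)
    span-∷ {a} a<b new (span u l) = span
      (All.map (λ { (i , a<i , i<b , refl) → new i a<i i<b }) l ∷ u)
      ((a , ≤-refl , a<b , refl) ∷ shift (n≤1+n a) ≤-refl l)

    -- A third visit to the vertex of `s a` would repeat one of its two states, and a vertex met
    -- both inside the loop and after it would interleave with the return from a to j.
    span-loop : ∀ {a j b xs ys} → a < j → j < b → b ≤ L → vtx (s a) ≡ vtx (s j) →
                Span (suc a) j xs → Span (suc j) b ys → Span a b (vtx (s a) ∷ xs ++ ys)
    span-loop {a} {j} {b} {xs} {ys} a<j j<b b≤L va≡vj (span u l) (span u′ l′) = span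
      (All.++⁺ (All.map fresh l) (All.map fresh′ l′) ∷ Unique.++⁺ u u′ (λ { (p , q) → apart (All.lookup l p) (All.lookup l′ q) }))
      ((a , ≤-refl , <-trans a<j j<b , refl) ∷
        All.++⁺ (shift (n≤1+n a) (<⇒≤ j<b) l) (shift (m≤n⇒m≤1+n (<⇒≤ a<j)) ≤-refl l′))
      where
      j<L : j < L
      j<L = <-≤-trans j<b b≤L
      sj : s j ≡ flip (s a)
      sj = vtx≡⇒ va≡vj (distinct< a<j j<L)
      fresh : ∀ {x} → ∃[ i ] (suc a ≤ i × i < j × vtx (s i) ≡ x) → vtx (s a) ≢ x
      fresh (i , a<i , i<j , refl) eq =
        distinct< i<j j<L (trans (vtx≡⇒ eq (distinct< a<i (<-trans i<j j<L))) (sym sj))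
      fresh′ : ∀ {x} → ∃[ i ] (suc j ≤ i × i < b × vtx (s i) ≡ x) → vtx (s a) ≢ x
      fresh′ (i , j<i , i<b , refl) eq =
        distinct< j<i i<L (trans sj (sym (vtx≡⇒ eq (distinct< (<-trans a<j j<i) i<L))))
        where
        i<L : i < L
        i<L = <-≤-trans i<b b≤L
      apart : ∀ {x} → ∃[ i ] (suc a ≤ i × i < j × vtx (s i) ≡ x) →
              ¬ (∃[ i ] (suc j ≤ i × i < b × vtx (s i) ≡ x))
      apart (i , a<i , i<j , refl) (k , j<k , k<b , eq) =
        noCrossing a<i i<j (<⇒≤ j<k) (<⇒≤ k<L) sj (vtx≡⇒ (sym eq) (distinct< (<-trans i<j j<k) k<L))
        where
        k<L : k < L
        k<L = <-≤-trans k<b b≤L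

    return? : ∀ a b → Dec (∃[ j ] (j < b × a < j × vtx (s a) ≡ vtx (s j)))
    return? a b = anyUpTo? (λ j → (a <? j) ×-dec (vtx (s a) F.≟ vtx (s j))) b

    -- Repeated vertices are nested, so cutting at a return to the initial vertex
    -- leaves a loop and a remainder with disjoint vertex sets.  There are at least two
    -- blocks inside a loop, since it cannot return along the edge on which it left.
    vertices : ∀ N a b → b ≤ N + a → a < b → b ≤ L →
               ∃[ xs ] (Span a b xs × 2 * b + 1 ≤ 3 * length xs + 2 * a)
    loopVertices : ∀ N a b → b ≤ N + a → a < b → b < L → vtx (s a) ≡ vtx (s b) →
                   ∃[ xs ] (Span (suc a) b xs × 2 * b + 2 ≤ 3 * length xs + 2 * suc a)

    -- Every position costs 2 and every listed vertex earns 3. A section is to have surplus at least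
    -- 1, the inside of a loop at least 2.
    vertices zero a b b≤ a<b b≤L = ⊥-elim (<⇒≱ a<b b≤)
    vertices (suc N) a b b≤ a<b b≤L with return? a b
    ... | no new with m≤n⇒m<n∨m≡n a<b
    ...   | inj₂ refl = vtx (s a) ∷ [] , span-∷ a<b (λ j a<j j<b eq → new (j , j<b , a<j , eq)) span-[] ,
                        ≤-reflexive (arith a)
      where
      arith : ∀ a → 2 * suc a + 1 ≡ 3 * 1 + 2 * a
      arith = solve-∀
    ...   | inj₁ a+1<b with xs , sp , le ← vertices N (suc a) b (subst (b ≤_) (sym (+-suc N a)) b≤) a+1<b b≤L =
      vtx (s a) ∷ xs , span-∷ a<b (λ j a<j j<b eq → new (j , j<b , a<j , eq)) sp ,
      ≤-trans le (≤-trans (n≤1+n _) (≤-reflexive (arith (length xs) a)))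
      where
      arith : ∀ l a → suc (3 * l + 2 * suc a) ≡ 3 * suc l + 2 * a
      arith = solve-∀
    -- The two ends a and j of the loop cost 4 and earn 3 for their common vertex. The surplus 2 of
    -- the inside pays the difference and leaves exactly 1.
    vertices (suc N) a b b≤ a<b b≤L | yes (j , j<b , a<j , eq)
      with xs , sp , le ← loopVertices N a j (s≤s⁻¹ (≤-trans j<b b≤)) a<j (<-≤-trans j<b b≤L) eq
      with m≤n⇒m<n∨m≡n j<b
    ... | inj₂ refl = vtx (s a) ∷ xs ++ [] , span-loop a<j j<b b≤L eq sp span-[] , (begin
        2 * suc j + 1                       ≡⟨ arith₁ j ⟩
        1 + (2 * j + 2)                     ≤⟨ s≤s le ⟩
        1 + (3 * length xs + 2 * suc a)     ≡⟨ arith₂ (length xs) a ⟩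
        3 * suc (length xs + 0) + 2 * a     ≡⟨ cong (λ l → 3 * suc l + 2 * a) (List.length-++ xs) ⟨
        3 * suc (length (xs ++ [])) + 2 * a ∎)
      where
      open ≤-Reasoning
      arith₁ : ∀ j → 2 * suc j + 1 ≡ 1 + (2 * j + 2)
      arith₁ = solve-∀
      arith₂ : ∀ l a → 1 + (3 * l + 2 * suc a) ≡ 3 * suc (l + 0) + 2 * a
      arith₂ = solve-∀
    ... | inj₁ j+1<b with ys , sp′ , le′ ← vertices N (suc j) b
                       (≤-trans b≤ (subst (suc (N + a) ≤_) (sym (+-suc N j)) (s≤s (+-monoʳ-≤ N (<⇒≤ a<j))))) j+1<b b≤L =
        vtx (s a) ∷ xs ++ ys , span-loop a<j j<b b≤L eq sp sp′ , (begin
        2 * b + 1                                     ≤⟨ le′ ⟩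
        3 * length ys + 2 * suc j                     ≡⟨ arith₁ (length ys) j ⟩
        3 * length ys + (2 * j + 2)                   ≤⟨ +-monoʳ-≤ (3 * length ys) le ⟩
        3 * length ys + (3 * length xs + 2 * suc a)   ≤⟨ n≤1+n _ ⟩
        suc (3 * length ys + (3 * length xs + 2 * suc a)) ≡⟨ arith₂ (length xs) (length ys) a ⟩
        3 * suc (length xs + length ys) + 2 * a       ≡⟨ cong (λ l → 3 * suc l + 2 * a) (List.length-++ xs) ⟨
        3 * suc (length (xs ++ ys)) + 2 * a           ∎)
      where
      open ≤-Reasoning
      arith₁ : ∀ l j → 3 * l + 2 * suc j ≡ 3 * l + (2 * j + 2)
      arith₁ = solve-∀
      arith₂ : ∀ l l′ a → suc (3 * l′ + (3 * l + 2 * suc a)) ≡ 3 * suc (l + l′) + 2 * a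
      arith₂ = solve-∀

    loopVertices N a b b≤ a<b b<L eq with m≤n⇒m<n∨m≡n a<b
    ... | inj₂ refl = ⊥-elim (vtx-suc≢ (<⇒≤ b<L) eq)
    ... | inj₁ a+1<b with m≤n⇒m<n∨m≡n a+1<b
    ...   | inj₂ refl = ⊥-elim (two≢ (<⇒≤ b<L) (vtx≡⇒ eq (distinct< a<b b<L)))
    loopVertices zero a b b≤ a<b b<L eq | inj₁ a+1<b | inj₁ a+2<b = ⊥-elim (<⇒≱ a<b b≤)
    loopVertices (suc N) a b b≤ a<b b<L eq | inj₁ a+1<b | inj₁ a+2<b with return? (suc a) b
    -- The first block is a single position, with surplus 1; the rest is nonempty and supplies the
    -- other 1.
    ... | no new with xs , sp , le ← vertices N (2 + a) b
                   (≤-trans b≤ (subst (suc (N + a) ≤_) (sym (+-suc N (suc a))) (s≤s (+-monoʳ-≤ N (n≤1+n a))))) a+2<b (<⇒≤ b<L) =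
      vtx (s (suc a)) ∷ xs , span-∷ a+1<b (λ j a<j j<b e → new (j , j<b , a<j , e)) sp ,
      (begin
        2 * b + 2                                   ≡⟨ arith₁ b ⟩
        1 + (2 * b + 1)                             ≤⟨ s≤s le ⟩
        1 + (3 * length xs + 2 * suc (suc a))       ≡⟨ arith₂ (length xs) a ⟩
        3 * suc (length xs) + 2 * suc a             ∎)
      where
      open ≤-Reasoning
      arith₁ : ∀ b → 2 * b + 2 ≡ 1 + (2 * b + 1)
      arith₁ = solve-∀
      arith₂ : ∀ l a → 1 + (3 * l + 2 * suc (suc a)) ≡ 3 * suc l + 2 * suc a
      arith₂ = solve-∀
    ... | yes (j , j<b , a+1<j , e)
      with xs , sp , le ← loopVertices N (suc a) j
             (subst (j ≤_) (sym (+-suc N a)) (≤-trans (<⇒≤ j<b) b≤)) a+1<j (<-trans j<b b<L) e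
      with m≤n⇒m<n∨m≡n j<b
    -- Here a single inner loop would fill the outer one, so the edges at positions a and j would
    -- join the same two vertices.
    ... | inj₂ refl = ⊥-elim (<⇒≢ (<-trans (n<1+n a) a+1<j) (unique (<-trans a<b b<L) (<-trans (n<1+n j) b<L) (inj₂ (eq , e))))
    ... | inj₁ j+1<b with ys , sp′ , le′ ← vertices N (suc j) b
                       (≤-trans b≤ (subst (suc (N + a) ≤_) (sym (+-suc N j)) (s≤s (+-monoʳ-≤ N (<⇒≤ (<-trans (n<1+n a) a+1<j)))))) j+1<b (<⇒≤ b<L) =
      vtx (s (suc a)) ∷ xs ++ ys , span-loop a+1<j j<b (<⇒≤ b<L) e sp sp′ , (begin
        2 * b + 2                                         ≡⟨ arith₀ b ⟩
        1 + (2 * b + 1)                                   ≤⟨ s≤s le′ ⟩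
        1 + (3 * length ys + 2 * suc j)                   ≡⟨ arith₁ (length ys) j ⟩
        1 + 3 * length ys + (2 * j + 2)                   ≤⟨ +-monoʳ-≤ (1 + 3 * length ys) le ⟩
        1 + 3 * length ys + (3 * length xs + 2 * suc (suc a)) ≡⟨ arith₂ (length xs) (length ys) a ⟩
        3 * suc (length xs + length ys) + 2 * suc a       ≡⟨ cong (λ l → 3 * suc l + 2 * suc a) (List.length-++ xs) ⟨
        3 * suc (length (xs ++ ys)) + 2 * suc a           ∎)
      where
      open ≤-Reasoning
      arith₀ : ∀ b → 2 * b + 2 ≡ 1 + (2 * b + 1)
      arith₀ = solve-∀
      arith₁ : ∀ l j → 1 + (3 * l + 2 * suc j) ≡ 1 + 3 * l + (2 * j + 2)
      arith₁ = solve-∀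
      arith₂ : ∀ l l′ a → 1 + 3 * l′ + (3 * l + 2 * suc (suc a)) ≡ 3 * suc (l + l′) + 2 * suc a
      arith₂ = solve-∀

    length-bound : 0 < L → 2 * L < 3 * n
    length-bound 0<L with xs , span u _ , le ← vertices L 0 L (≤-reflexive (sym (+-identityʳ L))) 0<L ≤-refl =
      subst (_≤ 3 * n) (+-comm (2 * L) 1) (≤-trans le
        (subst (_≤ 3 * n) (sym (+-identityʳ (3 * length xs))) (*-monoʳ-≤ 3 (unique⇒length≤ u))))

  -- Existence of an alternating circuit

  ⟦_⟧ : Bool → ℕ
  ⟦ b ⟧ = if b then 1 else 0

  sum-mono : ∀ {n} {f g : Fin n → ℕ} → (∀ i → f i ≤ g i) → sum f ≤ sum g
  sum-mono {zero}  le = z≤n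
  sum-mono {suc n} le = +-mono-≤ (le zero) (sum-mono (λ i → le (suc i)))

  sum-const-zero : ∀ {n} {f : Fin n → ℕ} → (∀ i → f i ≡ 0) → sum f ≡ 0
  sum-const-zero {n} eq = trans (sum-cong-≗ eq) (sum-replicate-zero n)

  sum-≟ : ∀ {n} (y : Fin n) → sum (λ z → ⟦ does (z F.≟ y) ⟧) ≡ 1
  sum-≟ {suc n} zero = cong suc (sum-const-zero {n} (λ _ → refl))
  sum-≟ (suc y) = sum-≟ y

  card-tabulate : ∀ {n} (f : Fin n → Bool) → ∣ Vec.tabulate f ∣ ≡ sum (λ i → ⟦ f i ⟧)
  card-tabulate {zero}  f = refl
  card-tabulate {suc n} f with f zero
  ... | true  = cong suc (card-tabulate (λ i → f (suc i)))
  ... | false = card-tabulate (λ i → f (suc i))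

  ≟-count≤ : ∀ {n} (f : Fin n → Bool) {y} → f y ≡ true → ∀ z → ⟦ does (z F.≟ y) ⟧ ≤ ⟦ f z ⟧
  ≟-count≤ f {y} fy z with z F.≟ y
  ... | yes refl = ≤-reflexive (sym (cong ⟦_⟧ fy))
  ... | no _     = z≤n

  ⟦⟧≤ : ∀ b → ⟦ b ⟧ ≤ 1
  ⟦⟧≤ true  = ≤-refl
  ⟦⟧≤ false = z≤n

  -- Two elements of one class force at least two of the other, so any one prescribed vertex can be
  -- avoided.
  another-neighbour : ∀ {n} {f g : Fin n → Bool} → sum (λ i → ⟦ f i ⟧) ≡ sum (λ i → ⟦ g i ⟧) →
                      ∀ {w w′} → f w ≡ true → f w′ ≡ true → w ≢ w′ → ∀ y → ∃[ z ] (z ≢ y × g z ≡ true)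
  another-neighbour {f = f} {g} eq {w} {w′} fw fw′ w≢w′ y
    with F.any? (λ z → ¬? (z F.≟ y) ×-dec (g z B.≟ true))
  ... | yes found = found
  ... | no none   = ⊥-elim (<-irrefl refl (begin
    2                                                                     ≡⟨ cong₂ _+_ (sum-≟ w) (sum-≟ w′) ⟨
    sum (λ z → ⟦ does (z F.≟ w) ⟧) + sum (λ z → ⟦ does (z F.≟ w′) ⟧)      ≡⟨ ∑-distrib-+ _ (λ z → ⟦ does (z F.≟ w′) ⟧) ⟨
    sum (λ z → ⟦ does (z F.≟ w) ⟧ + ⟦ does (z F.≟ w′) ⟧)                  ≤⟨ sum-mono two ⟩
    sum (λ z → ⟦ f z ⟧)                                                   ≡⟨ eq ⟩
    sum (λ z → ⟦ g z ⟧)                                                   ≤⟨ sum-mono one ⟩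
    sum (λ z → ⟦ does (z F.≟ y) ⟧)                                        ≡⟨ sum-≟ y ⟩
    1                                                                     ∎))
    where
    open ≤-Reasoning
    two : ∀ z → ⟦ does (z F.≟ w) ⟧ + ⟦ does (z F.≟ w′) ⟧ ≤ ⟦ f z ⟧
    two z with z F.≟ w
    ... | no _ = ≟-count≤ f fw′ z
    ... | yes refl with z F.≟ w′
    ...   | yes z≡w′ = ⊥-elim (w≢w′ z≡w′)
    ...   | no _     = ≤-reflexive (sym (cong ⟦_⟧ fw))
    one : ∀ z → ⟦ g z ⟧ ≤ ⟦ does (z F.≟ y) ⟧
    one z with z F.≟ y
    ... | yes _ = ⟦⟧≤ (g z)
    ... | no z≢y with g z in gz
    ...   | true  = ⊥-elim (none (z , z≢y , gz))
    ...   | false = z≤n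

  some-neighbour : ∀ {n} {f g : Fin n → Bool} → sum (λ i → ⟦ f i ⟧) ≡ sum (λ i → ⟦ g i ⟧) →
                   ∀ {w} → f w ≡ true → ∃[ z ] (g z ≡ true)
  some-neighbour {f = f} {g} eq {w} fw with F.any? (λ z → g z B.≟ true)
  ... | yes found = found
  ... | no none   = ⊥-elim (<-irrefl refl (begin
    1                                ≡⟨ sum-≟ w ⟨
    sum (λ z → ⟦ does (z F.≟ w) ⟧)   ≤⟨ sum-mono (≟-count≤ f fw) ⟩
    sum (λ z → ⟦ f z ⟧)              ≡⟨ eq ⟩
    sum (λ z → ⟦ g z ⟧)              ≡⟨ sum-const-zero zeros ⟩
    0                                ∎))
    where
    open ≤-Reasoning
    zeros : ∀ z → ⟦ g z ⟧ ≡ 0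
    zeros z with g z in gz
    ... | true  = ⊥-elim (none (z , gz))
    ... | false = refl

  Balanced : ∀ {n} → EdgeColouring n → Set
  Balanced D = ∀ c v → sum (λ z → ⟦ D c v z ⟧) ≡ sum (λ z → ⟦ D (not c) v z ⟧)

  _≟ₛ_ : ∀ {n} (x y : State n) → Dec (x ≡ y)
  _≟ₛ_ = ≡-dec F._≟_ B._≟_

  bit : Bool → Fin 2
  bit true  = suc zero
  bit false = zero

  bit-injective : ∀ {a b} → bit a ≡ bit b → a ≡ b
  bit-injective {true}  {true}  _ = refl
  bit-injective {false} {false} _ = refl

  encode : ∀ {n} → State n → Fin (n * 2)
  encode (v , c) = combine v (bit c)

  encode-injective : ∀ {n} {x y : State n} → encode x ≡ encode y → x ≡ y
  encode-injective {x = v , c} {w , d} eq with refl , e ← F.combine-injective v (bit c) w (bit d) eq =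
    cong (v ,_) (bit-injective e)

  stepStates : ∀ {n} → State n → State n → ℕ → State n
  stepStates x y zero    = x
  stepStates x y (suc _) = y

  -- Without circuits no state repeats along a trail, so a trail visits at most 2n states; but
  -- balance lets every trail that has started be prolonged. Hence there is no edge to start from.
  module CircuitFree {n} {D : EdgeColouring n} (isD : IsEdgeColouring D) (balanced : Balanced D)
    (none : ∀ {L} → ¬ Circuit D L) where

    open IsEdgeColouring isD

    stepTrail : ∀ {x y} → Step D x y → Trail D 1 (stepStates x y)
    stepTrail st = record { steps = λ { (s≤s z≤n) → st } ; unique = λ { (s≤s z≤n) (s≤s z≤n) _ → refl } }

    states-injective : ∀ {L s i j} → Trail D L s → i ≤ L → j ≤ L → s i ≡ s j → i ≡ j
    states-injective {i = i} {j} T i≤L j≤L eq with <-cmp i j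
    ... | tri< i<j _ _ = ⊥-elim (none (closeRepeat isD T i<j j≤L eq))
    ... | tri≈ _ i≡j _ = i≡j
    ... | tri> _ _ j<i = ⊥-elim (none (closeRepeat isD T j<i i≤L (sym eq)))

    -- The edges at the last vertex v in the colour c to be used next were used at most once
    -- before, namely when entering the state of v with the other colour.
    unused-edge : ∀ {t s} → Trail D (suc t) s →
                  ∃[ z ] (D (col (s (suc t))) (vtx (s (suc t))) z ≡ true ×
                    (∀ {k} → k < suc t → ¬ SamePair (vtx (s k)) (vtx (s (suc k))) (vtx (s (suc t))) z))
    unused-edge {t} {s} T = result
      where
      v : Fin n
      v = vtx (s (suc t))
      c : Bool
      c = col (s (suc t))
      colₜ : col (s t) ≡ not c
      colₜ = trans (sym (not-involutive _)) (cong not (sym (proj₂ (Trail.steps T ≤-refl))))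
      arrived : D (not c) v (vtx (s t)) ≡ true
      arrived = trans (D-sym _ _ _) (trans (cong (λ d → D d (vtx (s t)) v) (sym colₜ)) (proj₁ (Trail.steps T ≤-refl)))
      balance : sum (λ z → ⟦ D (not c) v z ⟧) ≡ sum (λ z → ⟦ D c v z ⟧)
      balance = trans (balanced (not c) v) (sum-cong-≗ (λ z → cong (λ d → ⟦ D d v z ⟧) (not-involutive c)))
      unused : ∀ {z} → D c v z ≡ true → (∀ k → k < suc t → s (suc k) ≡ flip (s (suc t)) → vtx (s k) ≢ z) →
               ∀ {k} → k < suc t → ¬ SamePair (vtx (s k)) (vtx (s (suc k))) v z
      unused {z} vz fresh {k} k< e = go e
        where
        colₖ : col (s k) ≡ c
        colₖ = D-colour e (proj₁ (Trail.steps T k<)) vz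
        go : ¬ SamePair (vtx (s k)) (vtx (s (suc k))) v z
        go (inj₁ (vk≡v , _)) = <⇒≢ k< (states-injective T (<⇒≤ k<) ≤-refl (cong₂ _,_ vk≡v colₖ))
        go (inj₂ (vk≡z , vk+1≡v)) = fresh k k<
          (cong₂ _,_ vk+1≡v (trans (proj₂ (Trail.steps T k<)) (cong not colₖ))) vk≡z
      -- The neighbour already joined to v on entering position i. Position 0 has no predecessor,
      -- and v is a mere default there: only positions of the form `suc k` are compared.
      previous : ℕ → Fin n
      previous zero    = v
      previous (suc i) = vtx (s i)
      previous-suc : ∀ {k i} → suc k ≡ i → vtx (s k) ≡ previous i
      previous-suc refl = refl
      left : ∀ {i} → i < suc t → s i ≡ flip (s (suc t)) → D (not c) v (vtx (s (suc i))) ≡ true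
      left {i} i< si = subst (λ x → D (col x) (vtx x) (vtx (s (suc i))) ≡ true) si (proj₁ (Trail.steps T i<))
      -- The edge leaving v at position i and the last edge are different edges of the trail, which
      -- provides the two neighbours for `another-neighbour`.
      vi+1≢vt : ∀ {i} → i < suc t → s i ≡ flip (s (suc t)) → vtx (s (suc i)) ≢ vtx (s t)
      vi+1≢vt i< si eq with refl ← Trail.unique T i< ≤-refl (inj₂ (cong vtx si , eq)) =
        step-loop isD (Trail.steps T i<) (cong vtx si)
      result : ∃[ z ] (D c v z ≡ true × (∀ {k} → k < suc t → ¬ SamePair (vtx (s k)) (vtx (s (suc k))) v z))
      result with anyUpTo? (λ i → s i ≟ₛ flip (s (suc t))) (suc t)
      ... | no never with z , vz ← some-neighbour balance arrived = z , vz , unused vz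
            (λ k k< eq _ → fresh k k< eq)
        where
        fresh : ∀ k → k < suc t → s (suc k) ≢ flip (s (suc t))
        fresh k k< eq with m≤n⇒m<n∨m≡n k<
        ... | inj₁ k+1<  = never (suc k , k+1< , eq)
        ... | inj₂ refl = flip≢ eq
      ... | yes (i , i< , si) with z , z≢ , vz ← another-neighbour balance (left i< si) arrived (vi+1≢vt i< si) (previous i)
        = z , vz , unused vz (λ k k< eq vk≡z → z≢ (trans (sym vk≡z)
            (previous-suc (states-injective T k< (<⇒≤ i<) (trans eq (sym si))))))

    long-trail : ∀ {x y} → Step D x y → ∀ t → ∃[ s ] Trail D (suc t) s
    long-trail {x} {y} st zero = stepStates x y , stepTrail st
    long-trail st (suc t) = extend (long-trail st t)
      where
      extend : (∃[ s ] Trail D (suc t) s) → ∃[ s ] Trail D (suc (suc t)) s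
      extend (s , T) with z , vz , unused ← unused-edge T =
        glueStates (suc t) s last ,
        subst (λ L → Trail D L (glueStates (suc t) s last)) (+-comm (suc t) 1)
          (glue {s = s} {t = last} T (stepTrail (vz , refl)) refl λ { i< (s≤s z≤n) → unused i< })
        where
        last : ℕ → State n
        last = stepStates (s (suc t)) (z , not (col (s (suc t))))

    edge-free : ∀ c u w → D c u w ≢ true
    edge-free c u w e = overlong (long-trail {u , c} {w , not c} (e , refl) (n * 2))
      where
      overlong : ∃[ s ] Trail D (suc (n * 2)) s → ⊥
      overlong (s , T) = repeat (F.pigeonhole (n<1+n (n * 2)) (λ k → encode (s (toℕ k))))
        where
        toℕ≤ : ∀ (k : Fin (suc (n * 2))) → toℕ k ≤ suc (n * 2)
        toℕ≤ k = <⇒≤ (F.toℕ<n k)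
        repeat : ∃[ i ] ∃[ j ] (toℕ i < toℕ j × encode (s (toℕ i)) ≡ encode (s (toℕ j))) → ⊥
        repeat (i , j , i<j , eq) = <⇒≢ i<j (states-injective T (toℕ≤ i) (toℕ≤ j) (encode-injective eq))

  -- Swaps

  T⇒≡ : ∀ {x} → T x → x ≡ true
  T⇒≡ = to T-≡

  ≡⇒T : ∀ {x} → x ≡ true → T x
  ≡⇒T = from T-≡

  ¬T⇒≡ : ∀ {x} → ¬ T x → x ≡ false
  ¬T⇒≡ ¬t = ¬-not (λ eq → ¬t (≡⇒T eq))

  ≡⇒¬T : ∀ {x} → x ≡ false → ¬ T x
  ≡⇒¬T refl ()

  T-ext : ∀ {x y} → T x ⇔ T y → x ≡ y
  T-ext {true}  {true}  _ = refl
  T-ext {false} {false} _ = refl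
  T-ext {true}  {false} e = ⊥-elim (to e tt)
  T-ext {false} {true}  e = ⊥-elim (from e tt)

  T-replace : ∀ {P Q : Set} {x} (p? : Dec P) (q? : Dec Q) →
              T (does p? ∨ (x ∧ not (does q?))) ⇔ ((T x × ¬ Q) ⊎ P)
  T-replace (yes p) _ = mk⇔ (λ _ → inj₂ p) (λ _ → tt)
  T-replace {x = x} (no ¬p) (yes q) = mk⇔ (λ t → ⊥-elim (subst T (∧-zeroʳ x) t))
    [ (λ { (_ , ¬q) → ⊥-elim (¬q q) }) , (λ p → ⊥-elim (¬p p)) ]′
  T-replace {x = x} (no ¬p) (no ¬q) = mk⇔ (λ t → inj₁ (subst T (∧-identityʳ x) t , ¬q))
    [ (λ { (t , _) → subst T (sym (∧-identityʳ x)) t }) , (λ p → ⊥-elim (¬p p)) ]′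

  _≈?_ : ∀ {n} (G H : Graph n) → Dec (G ≈ H)
  G ≈? H = F.all? (λ u → F.all? (λ v → adj G u v B.≟ adj H u v))

  adj-pair : ∀ {n} (G : Graph n) {u v x y} → SamePair u v x y → adj G u v ≡ adj G x y
  adj-pair G (inj₁ (refl , refl)) = refl
  adj-pair G {u} {v} (inj₂ (refl , refl)) = adj-sym G u v

  samePair? : ∀ {n} (u v x y : Fin n) → Dec (SamePair u v x y)
  samePair? u v x y = ((u F.≟ x) ×-dec (v F.≟ y)) ⊎-dec ((u F.≟ y) ×-dec (v F.≟ x))

  shared : ∀ {n} {u v x y x′ y′ : Fin n} → SamePair u v x y → SamePair u v x′ y′ → SamePair x y x′ y′
  shared (inj₁ (refl , refl)) q = q
  shared (inj₂ (refl , refl)) q = samePair-flipˡ q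

  share-right : ∀ {n} {x x′ y : Fin n} → x ≢ x′ → ¬ SamePair x y x′ y
  share-right x≢x′ (inj₁ (p , _)) = x≢x′ p
  share-right x≢x′ (inj₂ (refl , refl)) = x≢x′ refl

  share-left : ∀ {n} {x y y′ : Fin n} → y ≢ y′ → ¬ SamePair x y x y′
  share-left y≢y′ (inj₁ (_ , p)) = y≢y′ p
  share-left y≢y′ (inj₂ (refl , refl)) = y≢y′ refl

  disjoint-pairs : ∀ {n} {x y x′ y′ : Fin n} → x ≢ x′ → x ≢ y′ → ¬ SamePair x y x′ y′
  disjoint-pairs x≢x′ x≢y′ (inj₁ (p , _)) = x≢x′ p
  disjoint-pairs x≢x′ x≢y′ (inj₂ (p , _)) = x≢y′ p

  record AllDistinct {n} (a b c d : Fin n) : Set where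
    field
      a≢b : a ≢ b
      a≢c : a ≢ c
      a≢d : a ≢ d
      b≢c : b ≢ c
      b≢d : b ≢ d
      c≢d : c ≢ d

  allDistinct : ∀ {n} {a b c d : Fin n} → Unique (a ∷ b ∷ c ∷ d ∷ []) → AllDistinct a b c d
  allDistinct ((a≢b ∷ a≢c ∷ a≢d ∷ []) ∷ (b≢c ∷ b≢d ∷ []) ∷ (c≢d ∷ []) ∷ [] ∷ []) = record
    { a≢b = a≢b ; a≢c = a≢c ; a≢d = a≢d ; b≢c = b≢c ; b≢d = b≢d ; c≢d = c≢d }

  Swappable : ∀ {n} → Graph n → (a b c d : Fin n) → Set
  Swappable G a b c d =
    Unique (a ∷ b ∷ c ∷ d ∷ []) × Adj G a c × Adj G b d × ¬ Adj G b c × ¬ Adj G a d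

  swappable? : ∀ {n} (G : Graph n) a b c d → Dec (Swappable G a b c d)
  swappable? G a b c d =
    allPairs? (λ x y → ¬? (x F.≟ y)) (a ∷ b ∷ c ∷ d ∷ []) ×-dec T? _ ×-dec T? _ ×-dec ¬? (T? _) ×-dec ¬? (T? _)

  swap⇒swappable : ∀ {n} {G G′ : Graph n} (sw : Swap G G′) → let open Swap sw in Swappable G a b c d
  swap⇒swappable sw = distinct , ac∈E , bd∈E , bc∉E , ad∉E
    where open Swap sw

  module _ {n} (a b c d : Fin n) where

    Removed Added : (u v : Fin n) → Set
    Removed u v = SamePair u v a c ⊎ SamePair u v b d
    Added   u v = SamePair u v b c ⊎ SamePair u v a d

    removed? : ∀ u v → Dec (Removed u v)
    removed? u v = samePair? u v a c ⊎-dec samePair? u v b d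

    added? : ∀ u v → Dec (Added u v)
    added? u v = samePair? u v b c ⊎-dec samePair? u v a d

    swapAdj : (Fin n → Fin n → Bool) → Fin n → Fin n → Bool
    swapAdj A u v = does (added? u v) ∨ (A u v ∧ not (does (removed? u v)))

    swapAdj-spec : ∀ A u v → T (swapAdj A u v) ⇔ ((T (A u v) × ¬ Removed u v) ⊎ Added u v)
    swapAdj-spec A u v = T-replace (added? u v) (removed? u v)

    swapGraph : ∀ {G} → Swappable G a b c d → Graph n
    swapGraph {G} (distinct , _) = record
      { adj = swapAdj (adj G)
      ; adj-sym = λ u v → T-ext (mk⇔ (λ t → from (swapAdj-spec (adj G) v u) (turn (to (swapAdj-spec (adj G) u v) t)))
                                     (λ t → from (swapAdj-spec (adj G) u v) (turn (to (swapAdj-spec (adj G) v u) t))))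
      ; adj-irrefl = λ v → ¬T⇒≡ (λ t → loop (to (swapAdj-spec (adj G) v v) t)) }
      where
      open AllDistinct (allDistinct distinct)
      turn′ : ∀ {u v x y x′ y′ : Fin n} → SamePair u v x y ⊎ SamePair u v x′ y′ → SamePair v u x y ⊎ SamePair v u x′ y′
      turn′ (inj₁ p) = inj₁ (samePair-flipˡ p)
      turn′ (inj₂ p) = inj₂ (samePair-flipˡ p)
      turn : ∀ {u v} → (T (adj G u v) × ¬ Removed u v) ⊎ Added u v → (T (adj G v u) × ¬ Removed v u) ⊎ Added v u
      turn {u} {v} (inj₁ (t , ¬r)) = inj₁ (subst T (adj-sym G u v) t , λ r → ¬r (turn′ r))
      turn (inj₂ p) = inj₂ (turn′ p)
      loop : ∀ {v} → ¬ ((T (adj G v v) × ¬ Removed v v) ⊎ Added v v)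
      loop {v} (inj₁ (t , _)) = ≡⇒¬T (adj-irrefl G v) t
      loop (inj₂ (inj₁ (inj₁ (refl , refl)))) = b≢c refl
      loop (inj₂ (inj₁ (inj₂ (refl , refl)))) = b≢c refl
      loop (inj₂ (inj₂ (inj₁ (refl , refl)))) = a≢d refl
      loop (inj₂ (inj₂ (inj₂ (refl , refl)))) = a≢d refl

    swap : ∀ {G} (sw : Swappable G a b c d) → Swap G (swapGraph {G} sw)
    swap {G} (distinct , ac , bd , bc , ad) = record
      { a = a ; b = b ; c = c ; d = d ; distinct = distinct ; ac∈E = ac ; bd∈E = bd ; bc∉E = bc ; ad∉E = ad
      ; E′-spec = swapAdj-spec (adj G) }

  swap-adj : ∀ {n} {G G′ : Graph n} (sw : Swap G G′) → let open Swap sw in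
             ∀ u v → adj G′ u v ≡ swapAdj a b c d (adj G) u v
  swap-adj {G = G} sw u v = T-ext (mk⇔ (λ t → from spec (to (E′-spec u v) t)) (λ t → from (E′-spec u v) (to spec t)))
    where
    open Swap sw
    spec = swapAdj-spec a b c d (adj G) u v

  swap-resp : ∀ {n} {G G′ H H′ : Graph n} → G ≈ H → G′ ≈ H′ → Swap G G′ → Swap H H′
  swap-resp {G = G} {H = H} p q sw = record
    { a = a ; b = b ; c = c ; d = d ; distinct = distinct
    ; ac∈E = subst T (p a c) ac∈E ; bd∈E = subst T (p b d) bd∈E
    ; bc∉E = λ t → bc∉E (subst T (sym (p b c)) t) ; ad∉E = λ t → ad∉E (subst T (sym (p a d)) t)
    ; E′-spec = λ u v → subst₂ (λ g g′ → T g′ ⇔ ((T g × ¬ (SamePair u v a c ⊎ SamePair u v b d))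
        ⊎ (SamePair u v b c ⊎ SamePair u v a d))) (p u v) (q u v) (E′-spec u v) }
    where open Swap sw

  -- Interchanging a and b interchanges the removed pairs with the added ones.
  swap-sym : ∀ {n} {G G′ : Graph n} → Swap G G′ → Swap G′ G
  swap-sym {n} {G} {G′} sw = record
    { a = b ; b = a ; c = c ; d = d
    ; distinct = ((λ e → a≢b (sym e)) ∷ b≢c ∷ b≢d ∷ []) ∷ (a≢c ∷ a≢d ∷ []) ∷ (c≢d ∷ []) ∷ [] ∷ []
    ; ac∈E = from (E′-spec b c) (inj₂ (inj₁ (inj₁ (refl , refl))))
    ; bd∈E = from (E′-spec a d) (inj₂ (inj₂ (inj₁ (refl , refl))))
    ; bc∉E = λ t → gone (inj₁ (inj₁ (refl , refl))) (to (E′-spec a c) t)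
    ; ad∉E = λ t → gone (inj₂ (inj₁ (refl , refl))) (to (E′-spec b d) t)
    ; E′-spec = λ u v → mk⇔ back forth }
    where
    open Swap sw
    open AllDistinct (allDistinct distinct)
    apart : ∀ {u v} → Removed a b c d u v → ¬ Added a b c d u v
    apart (inj₁ p) (inj₁ q) = share-right a≢b (shared p q)
    apart (inj₁ p) (inj₂ q) = share-left c≢d (shared p q)
    apart (inj₂ p) (inj₁ q) = share-left (λ e → c≢d (sym e)) (shared p q)
    apart (inj₂ p) (inj₂ q) = share-right (λ e → a≢b (sym e)) (shared p q)
    gone : ∀ {u v} → Removed a b c d u v → ¬ ((Adj G u v × ¬ Removed a b c d u v) ⊎ Added a b c d u v)
    gone r (inj₁ (_ , ¬r)) = ¬r r
    gone r (inj₂ p) = apart r p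
    back : ∀ {u v} → Adj G u v → (Adj G′ u v × ¬ Added a b c d u v) ⊎ Removed a b c d u v
    back {u} {v} t with removed? a b c d u v
    ... | yes r = inj₂ r
    ... | no ¬r = inj₁ (from (E′-spec u v) (inj₁ (t , ¬r)) ,
            [ (λ p → bc∉E (subst T (adj-pair G p) t)) , (λ p → ad∉E (subst T (adj-pair G p) t)) ]′)
    forth : ∀ {u v} → (Adj G′ u v × ¬ Added a b c d u v) ⊎ Removed a b c d u v → Adj G u v
    forth {u} {v} (inj₁ (t , ¬p)) = [ proj₁ , (λ p → ⊥-elim (¬p p)) ]′ (to (E′-spec u v) t)
    forth (inj₂ (inj₁ p)) = subst T (sym (adj-pair G p)) ac∈E
    forth (inj₂ (inj₂ p)) = subst T (sym (adj-pair G p)) bd∈E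

  sequence-resp : ∀ {n k} {G G′ H : Graph n} → G ≈ G′ → SwapSequence k G H → SwapSequence k G′ H
  sequence-resp p (done q) = done (λ u v → trans (sym (p u v)) (q u v))
  sequence-resp p (step {G′ = G″} x s) = step {G′ = G″} (swap-resp {G′ = G″} {H′ = G″} p (λ _ _ → refl) x) s

  sequence-snoc : ∀ {n k} {G H H′ : Graph n} → SwapSequence k G H → Swap H H′ → SwapSequence (suc k) G H′
  sequence-snoc {G = G} {H} {H′} (done p) sw = step {G′ = H′} (swap-resp {G = H} {G′ = H′} {H = G} {H′ = H′} (λ u v → sym (p u v)) (λ _ _ → refl) sw) (done (λ _ _ → refl))
  sequence-snoc (step x s) sw = step x (sequence-snoc s sw)

  -- The four vertices determine the result of a swap up to `≈`, so it suffices to search through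
  -- quadruples and to test `swapGraph` for each.
  swapSequence? : ∀ {n} k (G H : Graph n) → Dec (SwapSequence k G H)
  swapSequence? zero G H = map′ done (λ { (done p) → p }) (G ≈? H)
  swapSequence? {n} (suc k) G H = map′ (λ { (a , b , c , d , sw , seq) → step (swap a b c d sw) seq }) first
    (F.any? λ a → F.any? λ b → F.any? λ c → F.any? λ d → via a b c d)
    where
    Via : (a b c d : Fin n) → Set
    Via a b c d = ∃[ sw ] SwapSequence k (swapGraph a b c d {G} sw) H
    via : ∀ a b c d → Dec (Via a b c d)
    via a b c d with swappable? G a b c d
    ... | no ¬sw = no λ { (sw , _) → ¬sw sw }
    ... | yes sw = map′ (sw ,_) (λ { (sw′ , seq) → sequence-resp {G = swapGraph a b c d sw′} {swapGraph a b c d sw} (λ _ _ → refl) seq })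
                     (swapSequence? k (swapGraph a b c d sw) H)
    first : SwapSequence (suc k) G H → ∃[ a ] ∃[ b ] ∃[ c ] ∃[ d ] Via a b c d
    first (step {G′ = G′} sw seq) = _ , _ , _ , _ , swap⇒swappable sw ,
      sequence-resp {G = G′} {swapGraph _ _ _ _ (swap⇒swappable sw)} (swap-adj sw) seq

  -- Counting the effect of a swap

  sum₅ : ∀ {n} (f a b c d : Fin n → ℕ) →
         sum (λ i → f i + (a i + (b i + (c i + d i)))) ≡ sum f + (sum a + (sum b + (sum c + sum d)))
  sum₅ f a b c d = trans (∑-distrib-+ f (λ i → a i + (b i + (c i + d i)))) (cong (sum f +_)
    (trans (∑-distrib-+ a (λ i → b i + (c i + d i))) (cong (sum a +_)
    (trans (∑-distrib-+ b (λ i → c i + d i)) (cong (sum b +_) (∑-distrib-+ c d))))))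

  isPair : ∀ {n} (u v x y : Fin n) → Bool
  isPair u v x y = does (samePair? u v x y)

  at : ∀ {n} → Fin n → Fin n → ℕ
  at u x = ⟦ does (u F.≟ x) ⟧

  pair-row : ∀ {n} {x y : Fin n} → x ≢ y → ∀ t u → sum (λ v → ⟦ isPair u v x y ∧ t ⟧) ≡ (at u x + at u y) * ⟦ t ⟧
  pair-row {x = x} {y} x≢y false u = trans (sum-const-zero (λ v → cong ⟦_⟧ (∧-zeroʳ (isPair u v x y))))
    (sym (*-zeroʳ (at u x + at u y)))
  pair-row {n} {x} {y} x≢y true u = trans (sum-cong-≗ (λ v → cong ⟦_⟧ (∧-identityʳ (isPair u v x y))))
    (trans go (sym (*-identityʳ (at u x + at u y))))
    where
    go : sum (λ v → ⟦ isPair u v x y ⟧) ≡ at u x + at u y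
    go with u F.≟ x | u F.≟ y
    ... | yes refl | yes refl = ⊥-elim (x≢y refl)
    ... | yes _    | no _     = trans (sum-cong-≗ (λ v → cong ⟦_⟧ (∨-identityʳ (does (v F.≟ y))))) (sum-≟ y)
    ... | no _     | yes _    = sum-≟ x
    ... | no _     | no _     = sum-const-zero {n} (λ _ → refl)

  pair-total : ∀ {n} {x y : Fin n} → x ≢ y → ∀ t → sum (λ u → sum (λ v → ⟦ isPair u v x y ∧ t ⟧)) ≡ 2 * ⟦ t ⟧
  pair-total {x = x} {y} x≢y t = trans (sum-cong-≗ (pair-row x≢y t)) (go t)
    where
    go : ∀ t → sum (λ u → (at u x + at u y) * ⟦ t ⟧) ≡ 2 * ⟦ t ⟧
    go false = sum-const-zero (λ u → *-zeroʳ (at u x + at u y))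
    go true  = trans (sum-cong-≗ (λ u → *-identityʳ (at u x + at u y)))
      (trans (∑-distrib-+ (λ u → at u x) (λ u → at u y)) (cong₂ _+_ (sum-≟ x) (sum-≟ y)))

  -- The contribution of a single ordered pair: on a removed or added pair, membership in the
  -- difference is negated, elsewhere it is kept. Old values are added on the left and negated ones
  -- on the right, which avoids subtraction.
  toggle : ∀ {P Q R S : Set} (p? : Dec P) (q? : Dec Q) (r? : Dec R) (s? : Dec S) {g h p q r s : Bool} →
    (P → g ≡ true × g xor h ≡ p) → (Q → g ≡ true × g xor h ≡ q) →
    (R → g ≡ false × g xor h ≡ r) → (S → g ≡ false × g xor h ≡ s) →
    (P → ¬ Q) → (R → ¬ S) →
    ⟦ ((does r? ∨ does s?) ∨ (g ∧ not (does p? ∨ does q?))) xor h ⟧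
      + (⟦ does p? ∧ p ⟧ + (⟦ does q? ∧ q ⟧ + (⟦ does r? ∧ r ⟧ + ⟦ does s? ∧ s ⟧)))
    ≡ ⟦ g xor h ⟧ + (⟦ does p? ∧ not p ⟧ + (⟦ does q? ∧ not q ⟧ + (⟦ does r? ∧ not r ⟧ + ⟦ does s? ∧ not s ⟧)))
  toggle (yes p) (yes q) _ _ _ _ _ _ pq _ = ⊥-elim (pq p q)
  toggle _ _ (yes r) (yes s) _ _ _ _ _ rs = ⊥-elim (rs r s)
  toggle (yes p) (no _) (yes r) (no _) fp fq fr fs _ _ with () ← trans (sym (proj₁ (fp p))) (proj₁ (fr r))
  toggle (yes p) (no _) (no _) (yes s) fp fq fr fs _ _ with () ← trans (sym (proj₁ (fp p))) (proj₁ (fs s))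
  toggle (no _) (yes q) (yes r) (no _) fp fq fr fs _ _ with () ← trans (sym (proj₁ (fq q))) (proj₁ (fr r))
  toggle (no _) (yes q) (no _) (yes s) fp fq fr fs _ _ with () ← trans (sym (proj₁ (fq q))) (proj₁ (fs s))
  toggle (yes p) (no _) (no _) (no _) {true} {false} fp fq fr fs _ _ with refl , refl ← fp p = refl
  toggle (yes p) (no _) (no _) (no _) {true} {true} fp fq fr fs _ _ with refl , refl ← fp p = refl
  toggle (yes p) (no _) (no _) (no _) {false} fp fq fr fs _ _ with () , _ ← fp p
  toggle (no _) (yes q) (no _) (no _) {true} {false} fp fq fr fs _ _ with refl , refl ← fq q = refl
  toggle (no _) (yes q) (no _) (no _) {true} {true} fp fq fr fs _ _ with refl , refl ← fq q = refl
  toggle (no _) (yes q) (no _) (no _) {false} fp fq fr fs _ _ with () , _ ← fq q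
  toggle (no _) (no _) (yes r) (no _) {false} {false} fp fq fr fs _ _ with refl , refl ← fr r = refl
  toggle (no _) (no _) (yes r) (no _) {false} {true} fp fq fr fs _ _ with refl , refl ← fr r = refl
  toggle (no _) (no _) (yes r) (no _) {true} fp fq fr fs _ _ with () , _ ← fr r
  toggle (no _) (no _) (no _) (yes s) {false} {false} fp fq fr fs _ _ with refl , refl ← fs s = refl
  toggle (no _) (no _) (no _) (yes s) {false} {true} fp fq fr fs _ _ with refl , refl ← fs s = refl
  toggle (no _) (no _) (no _) (yes s) {true} fp fq fr fs _ _ with () , _ ← fs s
  toggle (no _) (no _) (no _) (no _) {g} {h} fp fq fr fs _ _ = cong (λ z → ⟦ z xor h ⟧ + 0) (∧-identityʳ g)

  -- With `h` constantly false the row sums are degrees; with `h` the adjacency of a second graph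
  -- the total is the symmetric difference. One computation thus serves both.
  module SwapCount {n} {G G′ : Graph n} (sw : Swap G G′) (h : Fin n → Fin n → Bool)
    (h-sym : ∀ u v → h u v ≡ h v u) where

    open Swap sw

    x x′ : Fin n → Fin n → Bool
    x  u v = adj G u v xor h u v
    x′ u v = adj G′ u v xor h u v

    x-pair : ∀ {u v y z} → SamePair u v y z → x u v ≡ x y z
    x-pair (inj₁ (refl , refl)) = refl
    x-pair {u} {v} (inj₂ (refl , refl)) = cong₂ _xor_ (adj-sym G u v) (h-sym u v)

    open AllDistinct (allDistinct distinct)

    pointwise : ∀ u v →
      ⟦ x′ u v ⟧ + (⟦ isPair u v a c ∧ x a c ⟧ + (⟦ isPair u v b d ∧ x b d ⟧ +
                   (⟦ isPair u v b c ∧ x b c ⟧ + ⟦ isPair u v a d ∧ x a d ⟧)))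
      ≡ ⟦ x u v ⟧ + (⟦ isPair u v a c ∧ not (x a c) ⟧ + (⟦ isPair u v b d ∧ not (x b d) ⟧ +
                    (⟦ isPair u v b c ∧ not (x b c) ⟧ + ⟦ isPair u v a d ∧ not (x a d) ⟧)))
    pointwise u v = trans (cong (λ g → ⟦ g xor h u v ⟧ + others) (swap-adj sw u v))
      (toggle (samePair? u v a c) (samePair? u v b d) (samePair? u v b c) (samePair? u v a d)
        (λ p → trans (adj-pair G p) (T⇒≡ ac∈E) , x-pair p)
        (λ p → trans (adj-pair G p) (T⇒≡ bd∈E) , x-pair p)
        (λ p → trans (adj-pair G p) (¬T⇒≡ bc∉E) , x-pair p)
        (λ p → trans (adj-pair G p) (¬T⇒≡ ad∉E) , x-pair p)
        (λ p q → disjoint-pairs a≢b a≢d (shared p q))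
        (λ p q → disjoint-pairs (λ e → a≢b (sym e)) b≢d (shared p q)))
      where
      others : ℕ
      others = ⟦ isPair u v a c ∧ x a c ⟧ + (⟦ isPair u v b d ∧ x b d ⟧ +
               (⟦ isPair u v b c ∧ x b c ⟧ + ⟦ isPair u v a d ∧ x a d ⟧))

    -- The contribution of the four toggled pairs: `w` is the identity for their values before the
    -- swap and `not` for those after it.
    weighted : (f : Fin n → Fin n → Bool → ℕ) → (Bool → Bool) → ℕ
    weighted f w = f a c (w (x a c)) + (f b d (w (x b d)) + (f b c (w (x b c)) + f a d (w (x a d))))

    rowPair : Fin n → Fin n → Fin n → Bool → ℕ
    rowPair u y z t = sum (λ v → ⟦ isPair u v y z ∧ t ⟧)

    row : ∀ u → sum (λ v → ⟦ x′ u v ⟧) + weighted (rowPair u) (λ t → t)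
              ≡ sum (λ v → ⟦ x u v ⟧) + weighted (rowPair u) not
    row u = trans (sym (sum₅ _ (λ v → ⟦ isPair u v a c ∧ x a c ⟧) (λ v → ⟦ isPair u v b d ∧ x b d ⟧)
                              (λ v → ⟦ isPair u v b c ∧ x b c ⟧) (λ v → ⟦ isPair u v a d ∧ x a d ⟧)))
      (trans (sum-cong-≗ (pointwise u))
        (sum₅ _ (λ v → ⟦ isPair u v a c ∧ not (x a c) ⟧) (λ v → ⟦ isPair u v b d ∧ not (x b d) ⟧)
                (λ v → ⟦ isPair u v b c ∧ not (x b c) ⟧) (λ v → ⟦ isPair u v a d ∧ not (x a d) ⟧)))

    weighted-cong : ∀ {f g : Fin n → Fin n → Bool → ℕ} → (∀ {y z} → y ≢ z → ∀ t → f y z t ≡ g y z t) →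
                    ∀ w → weighted f w ≡ weighted g w
    weighted-cong e w = cong₂ _+_ (e a≢c _) (cong₂ _+_ (e b≢d _) (cong₂ _+_ (e b≢c _) (e a≢d _)))

    total : sum (λ u → sum (λ v → ⟦ x′ u v ⟧)) + weighted (λ _ _ t → 2 * ⟦ t ⟧) (λ t → t)
          ≡ sum (λ u → sum (λ v → ⟦ x u v ⟧)) + weighted (λ _ _ t → 2 * ⟦ t ⟧) not
    total = trans (cong (sum (λ u → sum (λ v → ⟦ x′ u v ⟧)) +_) (sym (weighted-cong pair-total (λ t → t))))
      (trans (sym (sum₅ _ (λ u → rowPair u a c (x a c)) (λ u → rowPair u b d (x b d))
                          (λ u → rowPair u b c (x b c)) (λ u → rowPair u a d (x a d))))
      (trans (sum-cong-≗ row)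
      (trans (sum₅ _ (λ u → rowPair u a c (not (x a c))) (λ u → rowPair u b d (not (x b d)))
                     (λ u → rowPair u b c (not (x b c))) (λ u → rowPair u a d (not (x a d))))
             (cong (sum (λ u → sum (λ v → ⟦ x u v ⟧)) +_) (weighted-cong pair-total not)))))

  -- Each of a, b, c, d lies in one removed and in one added pair.
  swap-degree : ∀ {n} {G G′ : Graph n} → Swap G G′ → ∀ u → degree G′ u ≡ degree G u
  swap-degree {n} {G} {G′} sw u = begin
    degree G′ u                     ≡⟨ card-tabulate (adj G′ u) ⟩
    sum (λ v → ⟦ adj G′ u v ⟧)      ≡⟨ sum-cong-≗ (λ v → cong ⟦_⟧ (sym (B.xor-identityʳ (adj G′ u v)))) ⟩
    sum (λ v → ⟦ x′ u v ⟧)          ≡⟨ +-cancelʳ-≡ _ _ _ balanced ⟩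
    sum (λ v → ⟦ x u v ⟧)           ≡⟨ sum-cong-≗ (λ v → cong ⟦_⟧ (B.xor-identityʳ (adj G u v))) ⟩
    sum (λ v → ⟦ adj G u v ⟧)       ≡⟨ card-tabulate (adj G u) ⟨
    degree G u                      ∎
    where
    open ≡-Reasoning
    open Swap sw
    open SwapCount sw (λ _ _ → false) (λ _ _ → refl)
    f : Fin n → Fin n → Bool → ℕ
    f y z t = (at u y + at u z) * ⟦ t ⟧
    xac : x a c ≡ true
    xac = trans (B.xor-identityʳ _) (T⇒≡ ac∈E)
    xbd : x b d ≡ true
    xbd = trans (B.xor-identityʳ _) (T⇒≡ bd∈E)
    xbc : x b c ≡ false
    xbc = trans (B.xor-identityʳ _) (¬T⇒≡ bc∉E)
    xad : x a d ≡ false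
    xad = trans (B.xor-identityʳ _) (¬T⇒≡ ad∉E)
    value : ∀ w → weighted f w ≡ f a c (w true) + (f b d (w true) + (f b c (w false) + f a d (w false)))
    value w = cong₂ _+_ (cong (λ t → f a c (w t)) xac) (cong₂ _+_ (cong (λ t → f b d (w t)) xbd)
      (cong₂ _+_ (cong (λ t → f b c (w t)) xbc) (cong (λ t → f a d (w t)) xad)))
    arith : ∀ a b c d → (a + c) * 1 + ((b + d) * 1 + ((b + c) * 0 + (a + d) * 0))
                      ≡ (a + c) * 0 + ((b + d) * 0 + ((b + c) * 1 + (a + d) * 1))
    arith = solve-∀
    same : weighted (rowPair u) (λ t → t) ≡ weighted (rowPair u) not
    same = trans (weighted-cong (λ y≢z t → pair-row y≢z t u) (λ t → t)) (trans (value (λ t → t))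
      (trans (arith (at u a) (at u b) (at u c) (at u d)) (trans (sym (value not))
        (sym (weighted-cong (λ y≢z t → pair-row y≢z t u) not)))))
    balanced : sum (λ v → ⟦ x′ u v ⟧) + weighted (rowPair u) not ≡ sum (λ v → ⟦ x u v ⟧) + weighted (rowPair u) not
    balanced = trans (cong (sum (λ v → ⟦ x′ u v ⟧) +_) (sym same)) (row u)

  swap-elsewhere : ∀ {n} {G G′ : Graph n} (sw : Swap G G′) → let open Swap sw in
                   ∀ {u v} → ¬ SamePair u v a c → ¬ SamePair u v b d → ¬ SamePair u v b c → ¬ SamePair u v a d →
                   adj G′ u v ≡ adj G u v
  swap-elsewhere {G = G} {G′} sw {u} {v} ¬ac ¬bd ¬bc ¬ad = T-ext (mk⇔ there back)
    where
    open Swap sw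
    there : Adj G′ u v → Adj G u v
    there t = [ proj₁ , [ (λ p → ⊥-elim (¬bc p)) , (λ p → ⊥-elim (¬ad p)) ]′ ]′ (to (E′-spec u v) t)
    back : Adj G u v → Adj G′ u v
    back t = from (E′-spec u v) (inj₁ (t , [ ¬ac , ¬bd ]′))

  -- Twice the number of edges in the symmetric difference.
  diffCount : ∀ {n} → Graph n → Graph n → ℕ
  diffCount G H = sum (λ u → sum (λ v → ⟦ adj G u v xor adj H u v ⟧))

  diffCount-comm : ∀ {n} (G H : Graph n) → diffCount G H ≡ diffCount H G
  diffCount-comm G H = sum-cong-≗ (λ u → sum-cong-≗ (λ v → cong ⟦_⟧ (xor-comm (adj G u v) (adj H u v))))

  minus : ∀ {n} → Graph n → Graph n → Fin n → Fin n → Bool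
  minus G H u v = adj G u v ∧ not (adj H u v)

  minus-true : ∀ {n} {G H : Graph n} {u v} → minus G H u v ≡ true → adj G u v ≡ true × adj H u v ≡ false
  minus-true {G = G} {H} {u} {v} eq with adj G u v | adj H u v
  ... | true | false = refl , refl

  -- One swap along an alternating path and its chord. As `diffCount` counts edges twice, 8 means
  -- that an alternating 4-cycle disappears, and 4 that three edges leave the difference while the
  -- chord enters it, in the colour of v₀v₁.
  record Exchange {n} (G H : Graph n) (v₀ v₁ v₂ v₃ : Fin n) : Set where
    field
      G₁ H₁     : Graph n
      swapped   : (Swap G G₁ × H₁ ≡ H) ⊎ (G₁ ≡ G × Swap H H₁)
      elsewhere : ∀ {u v} → ¬ SamePair u v v₀ v₁ → ¬ SamePair u v v₁ v₂ → ¬ SamePair u v v₂ v₃ →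
                  ¬ SamePair u v v₀ v₃ → adj G₁ u v ≡ adj G u v × adj H₁ u v ≡ adj H u v
      effect    : diffCount G₁ H₁ + 8 ≡ diffCount G H ⊎
                  (diffCount G₁ H₁ + 4 ≡ diffCount G H × minus G₁ H₁ v₀ v₃ ≡ true × adj G v₀ v₃ ≡ adj H v₀ v₃)

  -- If the chord is missing from G, the swap is made in G and adds it; if it lies in both graphs,
  -- the swap is made in H and removes it there. Either way the graphs come to agree on the three
  -- edges of the path.
  exchange : ∀ {n} (G H : Graph n) {v₀ v₁ v₂ v₃} → Unique (v₀ ∷ v₁ ∷ v₂ ∷ v₃ ∷ []) →
             minus G H v₀ v₁ ≡ true → minus H G v₁ v₂ ≡ true → minus G H v₂ v₃ ≡ true → minus G H v₀ v₃ ≡ false →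
             Exchange G H v₀ v₁ v₂ v₃
  exchange {n} G H {v₀} {v₁} {v₂} {v₃} ((v₀≢v₁ ∷ v₀≢v₂ ∷ v₀≢v₃ ∷ []) ∷ (v₁≢v₂ ∷ v₁≢v₃ ∷ []) ∷ (v₂≢v₃ ∷ []) ∷ [] ∷ [])
    e₀₁ e₁₂ e₂₃ e₀₃ = byChord (adj G v₀ v₃) (adj H v₀ v₃) refl refl
    where
    G₀₁ : adj G v₀ v₁ ≡ true
    G₀₁ = proj₁ (minus-true {G = G} {H} e₀₁)
    H₀₁ : adj H v₀ v₁ ≡ false
    H₀₁ = proj₂ (minus-true {G = G} {H} e₀₁)
    G₂₃ : adj G v₂ v₃ ≡ true
    G₂₃ = proj₁ (minus-true {G = G} {H} e₂₃)
    H₂₃ : adj H v₂ v₃ ≡ false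
    H₂₃ = proj₂ (minus-true {G = G} {H} e₂₃)
    G₂₁ : adj G v₂ v₁ ≡ false
    G₂₁ = trans (adj-sym G v₂ v₁) (proj₂ (minus-true {G = H} {G} e₁₂))
    H₂₁ : adj H v₂ v₁ ≡ true
    H₂₁ = trans (adj-sym H v₂ v₁) (proj₁ (minus-true {G = H} {G} e₁₂))

    removeFromG : adj G v₀ v₃ ≡ false → Swappable G v₀ v₂ v₁ v₃
    removeFromG chord = ((v₀≢v₂ ∷ v₀≢v₁ ∷ v₀≢v₃ ∷ []) ∷ ((λ e → v₁≢v₂ (sym e)) ∷ v₂≢v₃ ∷ []) ∷ (v₁≢v₃ ∷ []) ∷ [] ∷ []) ,
      ≡⇒T G₀₁ , ≡⇒T G₂₃ , ≡⇒¬T G₂₁ , ≡⇒¬T chord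

    removeFromH : adj H v₀ v₃ ≡ true → Swappable H v₂ v₀ v₁ v₃
    removeFromH chord = (((λ e → v₀≢v₂ (sym e)) ∷ (λ e → v₁≢v₂ (sym e)) ∷ v₂≢v₃ ∷ []) ∷ (v₀≢v₁ ∷ v₀≢v₃ ∷ []) ∷ (v₁≢v₃ ∷ []) ∷ [] ∷ []) ,
      ≡⇒T H₂₁ , ≡⇒T chord , ≡⇒¬T H₀₁ , ≡⇒¬T H₂₃

    weights : (w : Bool → Bool) → Bool → Bool → Bool → Bool → ℕ
    weights w p q r s = 2 * ⟦ w p ⟧ + (2 * ⟦ w q ⟧ + (2 * ⟦ w r ⟧ + 2 * ⟦ w s ⟧))

    count : ∀ {K K′ M : Graph n} (sw : Swap K K′) → let open Swap sw in ∀ {p q r s} →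
            adj K a c xor adj M a c ≡ p → adj K b d xor adj M b d ≡ q →
            adj K b c xor adj M b c ≡ r → adj K a d xor adj M a d ≡ s →
            diffCount K′ M + weights (λ t → t) p q r s ≡ diffCount K M + weights not p q r s
    count {M = M} sw refl refl refl refl = SwapCount.total sw (adj M) (adj-sym M)

    drop : ∀ {x y} k → x + k ≡ y + 2 → ∀ j → k ≡ j + 2 → x + j ≡ y
    drop {x} {y} k eq j refl = +-cancelʳ-≡ 2 _ _ (trans (+-assoc x j 2) eq)

    byChord : ∀ g h → adj G v₀ v₃ ≡ g → adj H v₀ v₃ ≡ h → Exchange G H v₀ v₁ v₂ v₃
    byChord true false gc hc with () ← trans (sym e₀₃) (cong₂ (λ g h → g ∧ not h) gc hc)
    byChord false h gc hc = record
      { G₁ = G′ ; H₁ = H ; swapped = inj₁ (sw , refl)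
      ; elsewhere = λ ¬01 ¬12 ¬23 ¬03 → swap-elsewhere sw ¬01 ¬23 (λ p → ¬12 (samePair-flipʳ p)) ¬03 , refl
      ; effect = eff h hc }
      where
      G′ : Graph n
      G′ = swapGraph _ _ _ _ {G} (removeFromG gc)
      sw : Swap G G′
      sw = swap _ _ _ _ {G} (removeFromG gc)
      eff : ∀ h → adj H v₀ v₃ ≡ h → diffCount G′ H + 8 ≡ diffCount G H ⊎
            (diffCount G′ H + 4 ≡ diffCount G H × minus G′ H v₀ v₃ ≡ true × adj G v₀ v₃ ≡ adj H v₀ v₃)
      eff true hc = inj₁ (trans
        (count {M = H} sw (cong₂ _xor_ G₀₁ H₀₁) (cong₂ _xor_ G₂₃ H₂₃) (cong₂ _xor_ G₂₁ H₂₁) (cong₂ _xor_ gc hc))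
        (+-identityʳ _))
      eff false hc = inj₂
        ( drop 6 (count {M = H} sw (cong₂ _xor_ G₀₁ H₀₁) (cong₂ _xor_ G₂₃ H₂₃) (cong₂ _xor_ G₂₁ H₂₁) (cong₂ _xor_ gc hc)) 4 refl
        , cong₂ (λ g h → g ∧ not h) (T⇒≡ (from (Swap.E′-spec sw v₀ v₃) (inj₂ (inj₂ (inj₁ (refl , refl)))))) hc
        , trans gc (sym hc))
    byChord true true gc hc = record
      { G₁ = G ; H₁ = H″ ; swapped = inj₂ (refl , sw)
      ; elsewhere = λ ¬01 ¬12 ¬23 ¬03 → refl , swap-elsewhere sw (λ p → ¬12 (samePair-flipʳ p)) ¬03 ¬01 ¬23
      ; effect = inj₂
        ( trans (cong (_+ 4) (diffCount-comm G H″)) (trans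
            (drop 6 (count {M = G} sw (cong₂ _xor_ H₂₁ G₂₁) (cong₂ _xor_ hc gc) (cong₂ _xor_ H₀₁ G₀₁) (cong₂ _xor_ H₂₃ G₂₃)) 4 refl)
            (diffCount-comm H G))
        , cong₂ (λ g h → g ∧ not h) gc (¬T⇒≡ (λ t → stays (to (Swap.E′-spec sw v₀ v₃) t)))
        , trans gc (sym hc)) }
      where
      H″ : Graph n
      H″ = swapGraph _ _ _ _ {H} (removeFromH hc)
      sw : Swap H H″
      sw = swap _ _ _ _ {H} (removeFromH hc)
      stays : ¬ ((Adj H v₀ v₃ × ¬ Removed v₂ v₀ v₁ v₃ v₀ v₃) ⊎ Added v₂ v₀ v₁ v₃ v₀ v₃)
      stays (inj₁ (_ , ¬r)) = ¬r (inj₂ (inj₁ (refl , refl)))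
      stays (inj₂ (inj₁ p)) = share-left (λ e → v₁≢v₃ (sym e)) p
      stays (inj₂ (inj₂ p)) = share-right v₀≢v₂ p

  -- Shortening a pair of realizations along circuits

  -- Indexing by colours lets one argument serve both alternations: the edges of colour c are those
  -- of `Γ c` that the other graph lacks.
  GraphPair : ℕ → Set
  GraphPair n = Bool → Graph n

  colouring : ∀ {n} → GraphPair n → EdgeColouring n
  colouring Γ c = minus (Γ c) (Γ (not c))

  isEdgeColouring : ∀ {n} (Γ : GraphPair n) → IsEdgeColouring (colouring Γ)
  isEdgeColouring Γ = record
    { D-sym = λ c u v → cong₂ (λ g h → g ∧ not h) (adj-sym (Γ c) u v) (adj-sym (Γ (not c)) u v)
    ; D-irrefl = λ c v → cong (_∧ not (adj (Γ (not c)) v v)) (adj-irrefl (Γ c) v)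
    ; D-excl = λ c u v eq → cong (_∧ not (adj (Γ (not (not c))) u v)) (proj₂ (minus-true {G = Γ c} {Γ (not c)} eq)) }

  diff : ∀ {n} → GraphPair n → ℕ
  diff Γ = diffCount (Γ true) (Γ false)

  diff-oriented : ∀ {n} (Γ : GraphPair n) c → diffCount (Γ c) (Γ (not c)) ≡ diff Γ
  diff-oriented Γ true  = refl
  diff-oriented Γ false = diffCount-comm (Γ false) (Γ true)

  oriented : ∀ {n} → Bool → Graph n → Graph n → GraphPair n
  oriented true  G H true  = G
  oriented true  G H false = H
  oriented false G H true  = H
  oriented false G H false = G

  oriented-diff : ∀ {n} c (G H : Graph n) → diff (oriented c G H) ≡ diffCount G H
  oriented-diff true  G H = refl
  oriented-diff false G H = diffCount-comm H G

  oriented-colouring : ∀ {n} c (G H : Graph n) u v → colouring (oriented c G H) c u v ≡ minus G H u v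
  oriented-colouring true  G H u v = refl
  oriented-colouring false G H u v = refl

  oriented-elsewhere : ∀ {n} (Γ : GraphPair n) c (G H : Graph n) {u v} →
    adj G u v ≡ adj (Γ c) u v → adj H u v ≡ adj (Γ (not c)) u v →
    ∀ c′ → colouring (oriented c G H) c′ u v ≡ colouring Γ c′ u v
  oriented-elsewhere Γ true  G H g h true  = cong₂ (λ x y → x ∧ not y) g h
  oriented-elsewhere Γ true  G H g h false = cong₂ (λ x y → x ∧ not y) h g
  oriented-elsewhere Γ false G H g h true  = cong₂ (λ x y → x ∧ not y) h g
  oriented-elsewhere Γ false G H g h false = cong₂ (λ x y → x ∧ not y) g h

  equal-adj⇒uncoloured : ∀ {n} (Γ : GraphPair n) c {u v} → adj (Γ c) u v ≡ adj (Γ (not c)) u v →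
                         ∀ c′ → colouring Γ c′ u v ≡ false
  equal-adj⇒uncoloured Γ true  {u} {v} eq true  = trans (cong (λ x → x ∧ not (adj (Γ false) u v)) eq) (B.∧-inverseʳ (adj (Γ false) u v))
  equal-adj⇒uncoloured Γ true  {u} {v} eq false = trans (cong (λ x → adj (Γ false) u v ∧ not x) eq) (B.∧-inverseʳ (adj (Γ false) u v))
  equal-adj⇒uncoloured Γ false {u} {v} eq true  = trans (cong (λ x → adj (Γ true) u v ∧ not x) eq) (B.∧-inverseʳ (adj (Γ true) u v))
  equal-adj⇒uncoloured Γ false {u} {v} eq false = trans (cong (λ x → x ∧ not (adj (Γ true) u v)) eq) (B.∧-inverseʳ (adj (Γ true) u v))

  SwapOne : ∀ {n} → GraphPair n → Bool → Graph n → Graph n → Set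
  SwapOne Γ c G H = (Swap (Γ c) G × H ≡ Γ (not c)) ⊎ (G ≡ Γ c × Swap (Γ (not c)) H)

  Linked : ∀ {n} → ℕ → GraphPair n → Set
  Linked k Γ = SwapSequence k (Γ true) (Γ false)

  -- A swap of `Γ true` is put at the beginning of the sequence; a swap of `Γ false` is reversed and
  -- put at its end.
  oriented-linked : ∀ {n k} (Γ : GraphPair n) c {G H} → SwapOne Γ c G H →
                    Linked k (oriented c G H) → Linked (suc k) Γ
  oriented-linked Γ true  (inj₁ (sw , refl)) seq = step sw seq
  oriented-linked Γ true  (inj₂ (refl , sw)) seq = sequence-snoc seq (swap-sym sw)
  oriented-linked Γ false (inj₁ (sw , refl)) seq = sequence-snoc seq (swap-sym sw)
  oriented-linked Γ false (inj₂ (refl , sw)) seq = step sw seq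

  oriented-degree : ∀ {n} (Γ : GraphPair n) c {G H} → SwapOne Γ c G H →
                    ∀ b u → degree (oriented c G H b) u ≡ degree (Γ b) u
  oriented-degree Γ true  (inj₁ (sw , refl)) true  u = swap-degree sw u
  oriented-degree Γ true  (inj₁ (sw , refl)) false u = refl
  oriented-degree Γ true  (inj₂ (refl , sw)) true  u = refl
  oriented-degree Γ true  (inj₂ (refl , sw)) false u = swap-degree sw u
  oriented-degree Γ false (inj₁ (sw , refl)) false u = swap-degree sw u
  oriented-degree Γ false (inj₁ (sw , refl)) true  u = refl
  oriented-degree Γ false (inj₂ (refl , sw)) false u = refl
  oriented-degree Γ false (inj₂ (refl , sw)) true  u = swap-degree sw u

  -- Using extra swaps, the symmetric difference loses 2(extra + 1) edges.
  record Reduction {n} (Γ : GraphPair n) (L : ℕ) : Set where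
    field
      reduced : GraphPair n
      extra   : ℕ
      short   : 2 * suc extra ≤ L
      drop    : diff reduced + 4 * suc extra ≡ diff Γ
      degrees : ∀ b u → degree (reduced b) u ≡ degree (Γ b) u
      link    : ∀ {k} → Linked k reduced → Linked (extra + k) Γ

  -- The induction on the length serves twice: to assume the circuit minimal, and to go on with the
  -- circuit that a swap leaves behind. The first use argues by contradiction, whence the double
  -- negation.
  reduce : ∀ {n} N {L} (Γ : GraphPair n) → L < N → Circuit (colouring Γ) L → ¬ ¬ Reduction Γ L
  reduce (suc N) {L} Γ L<N C ¬reduction = refute
    where
    open Circuit C
    open Trail trail
    open IsEdgeColouring (isEdgeColouring Γ)

    -- A reduction obtained from a shorter circuit is also one for L, since L enters only as an
    -- upper bound.
    minimal : ∀ {L′} → L′ < L → ¬ Circuit (colouring Γ) L′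
    minimal L′<L C′ = reduce N Γ (<-≤-trans L′<L (s≤s⁻¹ L<N)) C′ λ r → ¬reduction (record
      { reduced = Reduction.reduced r ; extra = Reduction.extra r
      ; short = ≤-trans (Reduction.short r) (<⇒≤ L′<L) ; drop = Reduction.drop r
      ; degrees = Reduction.degrees r ; link = Reduction.link r })

    open MinimalCircuit (isEdgeColouring Γ) state trail closed minimal

    -- Length 1 would be a loop, length 2 would use an edge twice, and length 3 has the wrong
    -- parity.
    3<L : 3 < L
    3<L = ≤∧≢⇒< (≤∧≢⇒< (≤∧≢⇒< positive 1≢L) 2≢L) 3≢L
      where
      1≢L : 1 ≢ L
      1≢L refl = vtx-suc≢ (s≤s z≤n) (sym (cong vtx closed))
      2≢L : 2 ≢ L
      2≢L refl with () ← unique {0} {1} (s≤s z≤n) ≤-refl (inj₂ (sym (cong vtx closed) , refl))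
      3≢L : 3 ≢ L
      3≢L refl = not-¬ refl (trans (sym (cong col closed)) (col-3+ (s≤s (s≤s (s≤s z≤n)))))

    -- A good chord would lead to a reduction, against `¬reduction`.
    good-chord : ∀ p → 3 + p ≤ L → ¬ ¬ BadChord p
    good-chord p 3+p≤L good = conclude (Exchange.effect ex)
      where
      open Chord {p} 3+p≤L 3<L good
      c : Bool
      c = col (state p)
      v₀ v₁ v₂ v₃ : Fin _
      v₀ = vtx (state p)
      v₁ = vtx (state (1 + p))
      v₂ = vtx (state (2 + p))
      v₃ = vtx (state (3 + p))
      e₁₂ : minus (Γ (not c)) (Γ c) v₁ v₂ ≡ true
      e₁₂ = subst (λ b → minus (Γ (not c)) (Γ b) v₁ v₂ ≡ true) (not-involutive c)
              (subst (λ b → colouring Γ b v₁ v₂ ≡ true) (proj₂ (steps p<L)) (proj₁ (steps p+1<L)))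
      e₂₃ : minus (Γ c) (Γ (not c)) v₂ v₃ ≡ true
      e₂₃ = subst (λ b → colouring Γ b v₂ v₃ ≡ true) (col-2+ p+1<L) (proj₁ (steps 3+p≤L))
      ex : Exchange (Γ c) (Γ (not c)) v₀ v₁ v₂ v₃
      ex = exchange (Γ c) (Γ (not c))
        ((vtx-suc≢ p<L ∷ p≢p+2 ∷ ends≢ ∷ []) ∷ (vtx-suc≢ p+1<L ∷ p+1≢p+3 ∷ []) ∷ (vtx-suc≢ 3+p≤L ∷ []) ∷ [] ∷ [])
        (proj₁ (steps p<L)) e₁₂ e₂₃ chord-colour
      open Exchange ex
      Γ′ : GraphPair _
      Γ′ = oriented c G₁ H₁
      count : ∀ k → diffCount G₁ H₁ + k ≡ diffCount (Γ c) (Γ (not c)) → diff Γ′ + k ≡ diff Γ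
      count k eq = trans (cong (_+ k) (oriented-diff c G₁ H₁)) (trans eq (diff-oriented Γ c))
      conclude : diffCount G₁ H₁ + 8 ≡ diffCount (Γ c) (Γ (not c)) ⊎
                 (diffCount G₁ H₁ + 4 ≡ diffCount (Γ c) (Γ (not c)) × minus G₁ H₁ v₀ v₃ ≡ true
                   × adj (Γ c) v₀ v₃ ≡ adj (Γ (not c)) v₀ v₃) → ⊥
      -- The final swap: four edges go at once, and `3<L` is the required 2 · 2 ≤ L.
      conclude (inj₁ eq) = ¬reduction (record
        { reduced = Γ′ ; extra = 1 ; short = 3<L ; drop = count 8 eq
        ; degrees = oriented-degree Γ c swapped ; link = oriented-linked Γ c swapped })
      conclude (inj₂ (eq , chord , same)) =
        reduce N Γ′ (<-≤-trans L∸2<L (s≤s⁻¹ L<N)) C′ λ r → ¬reduction (record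
          { reduced = Reduction.reduced r ; extra = suc (Reduction.extra r)
          ; short = subst₂ _≤_ (sym (*-suc 2 (suc (Reduction.extra r)))) (m+[n∸m]≡n 2≤L) (+-monoʳ-≤ 2 (Reduction.short r))
          ; drop = trans (arith (diff (Reduction.reduced r)) (Reduction.extra r))
                     (trans (cong (_+ 4) (Reduction.drop r)) (count 4 eq))
          ; degrees = λ b u → trans (Reduction.degrees r b u) (oriented-degree Γ c swapped b u)
          ; link = λ seq → oriented-linked Γ c swapped (Reduction.link r seq) })
        where
        arith : ∀ x i → x + 4 * suc (suc i) ≡ x + 4 * suc i + 4
        arith = solve-∀
        2≤L : 2 ≤ L
        2≤L = ≤-trans (n≤1+n 2) (<⇒≤ 3<L)
        L∸2<L : L ∸ 2 < L
        L∸2<L = ∸-monoʳ-< {L} {2} {0} (s≤s z≤n) 2≤L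
        not-chord : ∀ {k} → k < L → ¬ SamePair (vtx (state k)) (vtx (state (suc k))) v₀ v₃
        not-chord k<L e with () ← trans (sym (proj₁ (steps k<L))) (trans (D-pair e) (equal-adj⇒uncoloured Γ c same _))
        old : ∀ {k} → k < L → k ≢ p → k ≢ suc p → k ≢ suc (suc p) → Step (colouring Γ′) (state k) (state (suc k))
        old k<L k≢p k≢p+1 k≢p+2 = trans (oriented-elsewhere Γ c G₁ H₁ (proj₁ same′) (proj₂ same′) _) (proj₁ (steps k<L)) , proj₂ (steps k<L)
          where
          same′ = elsewhere (λ e → k≢p (unique k<L p<L e)) (λ e → k≢p+1 (unique k<L p+1<L e))
                    (λ e → k≢p+2 (unique k<L 3+p≤L e)) (not-chord k<L)
        C′ : Circuit (colouring Γ′) (L ∸ 2)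
        C′ = shortcut (isEdgeColouring Γ) p trail closed 3+p≤L 3<L old
               (trans (oriented-colouring c G₁ H₁ v₀ v₃) chord , col-3+ 3+p≤L) not-chord

    refute : ⊥
    refute = good-chord 0 (<⇒≤ 3<L) λ bad₀ → good-chord 1 3<L (not-both-bad 3<L bad₀)

  -- Induction on the size of the symmetric difference

  minus-degree : ∀ {n} (G H : Graph n) v →
    sum (λ z → ⟦ minus G H v z ⟧) + sum (λ z → ⟦ adj G v z ∧ adj H v z ⟧) ≡ degree G v
  minus-degree G H v = trans (sym (∑-distrib-+ _ (λ z → ⟦ adj G v z ∧ adj H v z ⟧)))
    (trans (sum-cong-≗ (λ z → split-bit (adj G v z) (adj H v z))) (sym (card-tabulate (adj G v))))
    where
    split-bit : ∀ g h → ⟦ g ∧ not h ⟧ + ⟦ g ∧ h ⟧ ≡ ⟦ g ⟧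
    split-bit true  true  = refl
    split-bit true  false = refl
    split-bit false _     = refl

  minus-balanced : ∀ {n} (G H : Graph n) v → degree G v ≡ degree H v →
    sum (λ z → ⟦ minus G H v z ⟧) ≡ sum (λ z → ⟦ minus H G v z ⟧)
  minus-balanced G H v eq = +-cancelʳ-≡ _ _ _ (trans (minus-degree G H v) (trans eq (trans (sym (minus-degree H G v))
    (cong (sum (λ z → ⟦ minus H G v z ⟧) +_) (sum-cong-≗ (λ z → cong ⟦_⟧ (B.∧-comm (adj H v z) (adj G v z))))))))

  colouring-balanced : ∀ {n} (Γ : GraphPair n) → (∀ v → degree (Γ true) v ≡ degree (Γ false) v) → Balanced (colouring Γ)
  colouring-balanced Γ eq true  v = minus-balanced (Γ true) (Γ false) v (eq v)
  colouring-balanced Γ eq false v = minus-balanced (Γ false) (Γ true) v (sym (eq v))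

  uncoloured⇒≈ : ∀ {n} (Γ : GraphPair n) → (∀ c u v → colouring Γ c u v ≢ true) → Γ true ≈ Γ false
  uncoloured⇒≈ Γ free u v with adj (Γ true) u v in g | adj (Γ false) u v in h
  ... | true  | true  = refl
  ... | false | false = refl
  ... | true  | false = ⊥-elim (free true u v (cong₂ (λ x y → x ∧ not y) g h))
  ... | false | true  = ⊥-elim (free false u v (cong₂ (λ x y → x ∧ not y) h g))

  ≈⇒diff≡0 : ∀ {n} (Γ : GraphPair n) → Γ true ≈ Γ false → diff Γ ≡ 0
  ≈⇒diff≡0 {n} Γ eq = sum-const-zero (λ u → sum-const-zero (λ v →
    cong ⟦_⟧ (trans (cong (_xor adj (Γ false) u v) (eq u v)) (B.xor-same (adj (Γ false) u v)))))

  -- Since `diff Γ` is four times H′, the inequality is k ≤ H′ · (1 - 4/(3n)) multiplied by 12n and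
  -- freed of subtraction.
  swaps-bound : ∀ {n} N (Γ : GraphPair n) → diff Γ < N → (∀ v → degree (Γ true) v ≡ degree (Γ false) v) →
                ¬ ¬ (∃[ k ] (Linked k Γ × 12 * n * k + 4 * diff Γ ≤ 3 * n * diff Γ))
  swaps-bound {n} (suc N) Γ E<N deg ¬goal = ¬goal (0 , done equal , ≤-reflexive (begin
    12 * n * 0 + 4 * diff Γ  ≡⟨ cong₂ _+_ (*-zeroʳ (12 * n)) (cong (4 *_) (≈⇒diff≡0 Γ equal)) ⟩
    0                        ≡⟨ *-zeroʳ (3 * n) ⟨
    3 * n * 0                ≡⟨ cong (3 * n *_) (≈⇒diff≡0 Γ equal) ⟨
    3 * n * diff Γ           ∎))
    where
    open ≡-Reasoning
    -- With the goal refuted there is no circuit at all: induction on the length makes it minimal,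
    -- so that `length-bound` applies, and its reduction leaves a pair with a smaller difference,
    -- from which the goal follows. Without circuits the two graphs are equal and no swap is made.
    none : ∀ M {L} → L < M → ¬ Circuit (colouring Γ) L
    none (suc M) {L} L<M C = reduce (suc L) Γ ≤-refl C continue
      where
      open Circuit C
      open MinimalCircuit (isEdgeColouring Γ) state trail closed
        (λ L′<L → none M (<-≤-trans L′<L (s≤s⁻¹ L<M)))
      continue : ¬ Reduction Γ L
      continue r = swaps-bound N reduced (<-≤-trans E′<E (s≤s⁻¹ E<N))
        (λ v → trans (degrees true v) (trans (deg v) (sym (degrees false v))))
        λ { (k , seq , le) → ¬goal (extra + k , link seq , bound k le) }
        where
        open Reduction r
        E′<E : diff reduced < diff Γ
        E′<E = subst (diff reduced <_) drop (m<m+n (diff reduced) (s≤s z≤n))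
        4j≤3n : 4 * suc extra ≤ 3 * n
        4j≤3n = ≤-trans (≤-reflexive (*-assoc 2 2 (suc extra))) (≤-trans (*-monoʳ-≤ 2 short) (<⇒≤ (length-bound positive)))
        arith₁ : ∀ n i k x → 12 * n * (i + k) + 4 * (x + 4 * suc i) ≡ (12 * n * k + 4 * x) + (12 * n * i + 4 * (4 * suc i))
        arith₁ = solve-∀
        arith₂ : ∀ n i x → 3 * n * x + (12 * n * i + 4 * (3 * n)) ≡ 3 * n * (x + 4 * suc i)
        arith₂ = solve-∀
        bound : ∀ k → 12 * n * k + 4 * diff reduced ≤ 3 * n * diff reduced →
                12 * n * (extra + k) + 4 * diff Γ ≤ 3 * n * diff Γ
        -- Both sides grow by a common 12 · n · extra; the remaining increments are 4 times the two
        -- sides of `4j≤3n`.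
        bound k le = subst (λ E → 12 * n * (extra + k) + 4 * E ≤ 3 * n * E) drop
          (≤-trans (≤-reflexive (arith₁ n extra k (diff reduced)))
          (≤-trans (+-mono-≤ le (+-monoʳ-≤ (12 * n * extra) (*-monoʳ-≤ 4 4j≤3n)))
                   (≤-reflexive (arith₂ n extra (diff reduced)))))
    equal : Γ true ≈ Γ false
    equal = uncoloured⇒≈ Γ (CircuitFree.edge-free (isEdgeColouring Γ) (colouring-balanced Γ deg)
      (λ {L} → none (suc L) ≤-refl))

  -- Counting the symmetric difference

  length-filter₂ : ∀ {A : Set} {P Q : A → Set} (P? : Decidable P) (Q? : Decidable Q) xs →
                   length (filter P? (filter Q? xs)) ≡ ListAction.sum (map (λ x → ⟦ does (Q? x) ∧ does (P? x) ⟧) xs)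
  length-filter₂ P? Q? [] = refl
  length-filter₂ P? Q? (x ∷ xs) with does (Q? x)
  ... | false = length-filter₂ P? Q? xs
  ... | true with does (P? x)
  ...   | false = length-filter₂ P? Q? xs
  ...   | true  = cong suc (length-filter₂ P? Q? xs)

  sum-cartesianProduct : ∀ {A B : Set} (f : A × B → ℕ) xs ys →
    ListAction.sum (map f (cartesianProduct xs ys)) ≡ ListAction.sum (map (λ x → ListAction.sum (map (λ y → f (x , y)) ys)) xs)
  sum-cartesianProduct f [] ys = refl
  sum-cartesianProduct f (x ∷ xs) ys = begin
    ListAction.sum (map f (map (x ,_) ys ++ cartesianProduct xs ys))
      ≡⟨ cong ListAction.sum (List.map-++ f (map (x ,_) ys) (cartesianProduct xs ys)) ⟩
    ListAction.sum (map f (map (x ,_) ys) ++ map f (cartesianProduct xs ys))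
      ≡⟨ ListAction.sum-++ (map f (map (x ,_) ys)) _ ⟩
    ListAction.sum (map f (map (x ,_) ys)) + ListAction.sum (map f (cartesianProduct xs ys))
      ≡⟨ cong₂ _+_ (cong ListAction.sum (sym (List.map-∘ ys))) (sum-cartesianProduct f xs ys) ⟩
    ListAction.sum (map (λ y → f (x , y)) ys) + ListAction.sum (map (λ x → ListAction.sum (map (λ y → f (x , y)) ys)) xs) ∎
    where open ≡-Reasoning

  sum-tabulate : ∀ {A : Set} {n} (f : A → ℕ) (g : Fin n → A) → ListAction.sum (map f (tabulate g)) ≡ sum (λ i → f (g i))
  sum-tabulate {n = zero}  f g = refl
  sum-tabulate {n = suc n} f g = cong (f (g zero) +_) (sum-tabulate f (λ i → g (suc i)))

  dichotomy : ∀ {P Q : Set} (p? : Dec P) (q? : Dec Q) {a b} → (P → ¬ Q) → a ≡ b → (¬ P → ¬ Q → a ≡ false) →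
              ⟦ a ⟧ ≡ ⟦ does p? ∧ a ⟧ + ⟦ does q? ∧ b ⟧
  dichotomy (yes p) (yes q) pq _    _ = ⊥-elim (pq p q)
  dichotomy (yes p) (no _)  _  _    _ = sym (+-identityʳ _)
  dichotomy (no _)  (yes q) _  refl _ = refl
  dichotomy (no ¬p) (no ¬q) _  _ none = cong ⟦_⟧ (none ¬p ¬q)

  -- Each edge {u , v} of the symmetric difference with u < v is counted in row u and in row v.
  handshake : ∀ {n} (G H : Graph n) → 2 * length (symDiff G H) ≡ diffCount G H
  handshake {n} G H = sym (begin
    sum (λ u → sum (λ v → ⟦ x u v ⟧))                               ≡⟨ sum-cong-≗ (λ u → trans (sum-cong-≗ (ordered u)) (∑-distrib-+ (below u) _)) ⟩
    sum (λ u → sum (below u) + sum (λ v → below v u))               ≡⟨ ∑-distrib-+ (λ u → sum (below u)) _ ⟩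
    sum (λ u → sum (below u)) + sum (λ u → sum (λ v → below v u))   ≡⟨ cong (sum (λ u → sum (below u)) +_) (∑-comm (λ u v → below v u)) ⟩
    sum (λ u → sum (below u)) + sum (λ u → sum (below u))           ≡⟨ cong₂ _+_ counted (trans counted (sym (+-identityʳ _))) ⟩
    2 * length (symDiff G H)                                        ∎)
    where
    open ≡-Reasoning
    x : Fin n → Fin n → Bool
    x u v = adj G u v xor adj H u v
    below : Fin n → Fin n → ℕ
    below u v = ⟦ does (u F.<? v) ∧ x u v ⟧
    x-sym : ∀ u v → x u v ≡ x v u
    x-sym u v = cong₂ _xor_ (adj-sym G u v) (adj-sym H u v)
    counted : sum (λ u → sum (below u)) ≡ length (symDiff G H)
    counted = sym (begin
      length (symDiff G H)
        ≡⟨ length-filter₂ (λ { (u , v) → T? (x u v) }) (λ { (u , v) → u F.<? v }) (cartesianProduct (allFin n) (allFin n)) ⟩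
      ListAction.sum (map (λ { (u , v) → below u v }) (cartesianProduct (allFin n) (allFin n)))
        ≡⟨ sum-cartesianProduct (λ { (u , v) → below u v }) (allFin n) (allFin n) ⟩
      ListAction.sum (map (λ u → ListAction.sum (map (below u) (allFin n))) (allFin n))
        ≡⟨ sum-tabulate (λ u → ListAction.sum (map (below u) (allFin n))) (λ u → u) ⟩
      sum (λ u → ListAction.sum (map (below u) (allFin n)))
        ≡⟨ sum-cong-≗ (λ u → sum-tabulate (below u) (λ v → v)) ⟩
      sum (λ u → sum (below u)) ∎)
    ordered : ∀ u v → ⟦ x u v ⟧ ≡ below u v + below v u
    ordered u v = dichotomy (u F.<? v) (v F.<? u) <-asym (x-sym u v) λ u≮v v≮u →
      diagonal (F.toℕ-injective (≤-antisym (≮⇒≥ v≮u) (≮⇒≥ u≮v)))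
      where
      diagonal : ∀ {u v} → u ≡ v → x u v ≡ false
      diagonal {u} refl = cong₂ _xor_ (adj-irrefl G u) (adj-irrefl H u)

  sum-lookup : ∀ {n} (f : ℕ → ℕ) (d : Vec ℕ n) → sum (λ i → f (Vec.lookup d i)) ≡ Vec.sum (Vec.map f d)
  sum-lookup f [] = refl
  sum-lookup f (x ∷ d) = cong (f x +_) (sum-lookup f d)

  complement : ∀ {n} (f : Fin n → Bool) → sum (λ i → ⟦ not (f i) ⟧) ≡ n ∸ sum (λ i → ⟦ f i ⟧)
  complement {n} f = sym (trans (cong (_∸ sum (λ i → ⟦ f i ⟧)) (sym (all f))) (m+n∸n≡m _ (sum (λ i → ⟦ f i ⟧))))
    where
    all : ∀ {n} (f : Fin n → Bool) → sum (λ i → ⟦ not (f i) ⟧) + sum (λ i → ⟦ f i ⟧) ≡ n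
    all {zero} f = refl
    all {suc n} f with f zero
    ... | true  = trans (+-suc _ _) (cong suc (all (λ i → f (suc i))))
    ... | false = cong suc (all (λ i → f (suc i)))

  -- Where two rows differ, one has an entry 1 and the other an entry 0. So the differences are at
  -- most the 1s of both rows together, 2k, and at most the 0s, 2(n - k); the 0 on the diagonal is
  -- among the latter.
  diff-row≤ : ∀ {n} (G H : Graph n) {k} u → degree G u ≡ k → degree H u ≡ k →
              sum (λ v → ⟦ adj G u v xor adj H u v ⟧) ≤ 2 * (k ⊓ (n ∸ k))
  diff-row≤ {n} G H {k} u dG dH = ≤-trans (⊓-glb ones zeros) (≤-reflexive (sym (*-distribˡ-⊓ 2 k (n ∸ k))))
    where
    xor≤ : ∀ g h → ⟦ g xor h ⟧ ≤ ⟦ g ⟧ + ⟦ h ⟧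
    xor≤ true  true  = z≤n
    xor≤ true  false = ≤-refl
    xor≤ false h     = ≤-refl
    xor≤not : ∀ g h → ⟦ g xor h ⟧ ≤ ⟦ not g ⟧ + ⟦ not h ⟧
    xor≤not true  true  = z≤n
    xor≤not true  false = ≤-refl
    xor≤not false true  = ≤-refl
    xor≤not false false = z≤n
    sG : sum (λ v → ⟦ adj G u v ⟧) ≡ k
    sG = trans (sym (card-tabulate (adj G u))) dG
    sH : sum (λ v → ⟦ adj H u v ⟧) ≡ k
    sH = trans (sym (card-tabulate (adj H u))) dH
    double : ∀ {x y z} → x ≡ z → y ≡ z → x + y ≡ 2 * z
    double {z = z} refl refl = cong (z +_) (sym (+-identityʳ z))
    ones : sum (λ v → ⟦ adj G u v xor adj H u v ⟧) ≤ 2 * k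
    ones = ≤-trans (sum-mono (λ v → xor≤ (adj G u v) (adj H u v)))
      (≤-reflexive (trans (∑-distrib-+ _ (λ v → ⟦ adj H u v ⟧)) (double sG sH)))
    zeros : sum (λ v → ⟦ adj G u v xor adj H u v ⟧) ≤ 2 * (n ∸ k)
    zeros = ≤-trans (sum-mono (λ v → xor≤not (adj G u v) (adj H u v)))
      (≤-reflexive (trans (∑-distrib-+ _ (λ v → ⟦ not (adj H u v) ⟧))
        (double (trans (complement (adj G u)) (cong (n ∸_) sG)) (trans (complement (adj H u)) (cong (n ∸_) sH)))))

  sum-double : ∀ {n} (f : Fin n → ℕ) → sum (λ i → 2 * f i) ≡ 2 * sum f
  sum-double f = trans (∑-distrib-+ f (λ i → f i + 0)) (cong (sum f +_)
    (trans (sum-cong-≗ (λ i → +-identityʳ (f i))) (sym (+-identityʳ (sum f)))))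

  symDiff≤ : ∀ {n} (d : Vec ℕ n) (G H : Graph n) → Realizes G d → Realizes H d →
             length (symDiff G H) ≤ Vec.sum (Vec.map (λ dᵢ → dᵢ ⊓ (n ∸ dᵢ)) d)
  symDiff≤ {n} d G H rG rH = *-cancelˡ-≤ 2 (begin
    2 * length (symDiff G H)                                ≡⟨ handshake G H ⟩
    diffCount G H                                           ≤⟨ sum-mono (λ u → diff-row≤ G H u (rG u) (rH u)) ⟩
    sum (λ u → 2 * (Vec.lookup d u ⊓ (n ∸ Vec.lookup d u)))         ≡⟨ sum-double (λ u → Vec.lookup d u ⊓ (n ∸ Vec.lookup d u)) ⟩
    2 * sum (λ u → Vec.lookup d u ⊓ (n ∸ Vec.lookup d u))           ≡⟨ cong (2 *_) (sum-lookup (λ dᵢ → dᵢ ⊓ (n ∸ dᵢ)) d) ⟩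
    2 * Vec.sum (Vec.map (λ dᵢ → dᵢ ⊓ (n ∸ dᵢ)) d)          ∎)
    where open ≤-Reasoning

  sum-map≤ : ∀ {n} (f : ℕ → ℕ) → (∀ x → f x ≤ x) → (d : Vec ℕ n) → Vec.sum (Vec.map f d) ≤ Vec.sum d
  sum-map≤ f le [] = z≤n
  sum-map≤ f le (x ∷ d) = +-mono-≤ (le x) (sum-map≤ f le d)

  least : ∀ {P : ℕ → Set} → (∀ k → Dec (P k)) → ∀ k → P k → ∃[ m ] (P m × (∀ j → P j → m ≤ j))
  least P? k pk with P? 0
  ... | yes p0 = 0 , p0 , λ _ _ → z≤n
  least P? zero pk | no ¬p0 = ⊥-elim (¬p0 pk)
  least {P} P? (suc k) pk | no ¬p0 with m , pm , min ← least (λ k → P? (suc k)) k pk =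
    suc m , pm , λ { zero p0 → ⊥-elim (¬p0 p0) ; (suc j) pj → s≤s (min j pj) }

open SwapBound

open import Data.Integer as ℤ using (+_)
import Data.Integer.Properties as ℤ
open import Data.Rational using (1ℚ; ½; _/_; _+_; _*_; _-_; -_; _≤_; toℚᵘ)
import Data.Rational.Properties as ℚ
open import Data.Rational.Unnormalised as ℚᵘ using (mkℚᵘ; *≡*; *≤*)
import Data.Rational.Unnormalised.Properties as ℚᵘ

-- Rational arithmetic

/-mono-≤ : ∀ {a b c d} .{{_ : NonZero b}} .{{_ : NonZero d}} → a ℕ.* d ℕ.≤ c ℕ.* b → + a / b ≤ + c / d
/-mono-≤ {a} {suc b} {c} {suc d} le = ℚ.toℚᵘ-cancel-≤ (ℚᵘ.≤-respˡ-≃ (ℚᵘ.≃-sym (ℚ.toℚᵘ-fromℚᵘ (mkℚᵘ (+ a) b)))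
  (ℚᵘ.≤-respʳ-≃ (ℚᵘ.≃-sym (ℚ.toℚᵘ-fromℚᵘ (mkℚᵘ (+ c) d)))
    (*≤* (subst₂ ℤ._≤_ (ℤ.pos-* a (suc d)) (ℤ.pos-* c (suc b)) (ℤ.+≤+ le)))))

/-≡ : ∀ {a b c d} .{{_ : NonZero b}} .{{_ : NonZero d}} → a ℕ.* d ≡ c ℕ.* b → + a / b ≡ + c / d
/-≡ {a} {b} {c} {d} eq = ℚ.≤-antisym (/-mono-≤ {a} {b} {c} {d} (ℕ.≤-reflexive eq))
                                     (/-mono-≤ {c} {d} {a} {b} (ℕ.≤-reflexive (sym eq)))

/-*-/ : ∀ a b c d .{{_ : NonZero b}} .{{_ : NonZero d}} →
        let instance bd≢0 = m*n≢0 b d in (+ a / b) * (+ c / d) ≡ + (a ℕ.* c) / (b ℕ.* d)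
/-*-/ a (suc b) c (suc d) = ℚ.toℚᵘ-injective (begin
  toℚᵘ ((+ a / suc b) * (+ c / suc d))             ≈⟨ ℚ.toℚᵘ-homo-* (+ a / suc b) (+ c / suc d) ⟩
  toℚᵘ (+ a / suc b) ℚᵘ.* toℚᵘ (+ c / suc d)       ≈⟨ ℚᵘ.*-cong (ℚ.toℚᵘ-fromℚᵘ (mkℚᵘ (+ a) b)) (ℚ.toℚᵘ-fromℚᵘ (mkℚᵘ (+ c) d)) ⟩
  mkℚᵘ (+ a) b ℚᵘ.* mkℚᵘ (+ c) d                   ≈⟨ *≡* (cong (ℤ._* + (suc b ℕ.* suc d)) (sym (ℤ.pos-* a c))) ⟩
  mkℚᵘ (+ (a ℕ.* c)) _                             ≈⟨ ℚ.toℚᵘ-fromℚᵘ (mkℚᵘ (+ (a ℕ.* c)) (d ℕ.+ b ℕ.* suc d)) ⟨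
  toℚᵘ (+ (a ℕ.* c) / (suc b ℕ.* suc d))           ∎)
  where open import Relation.Binary.Reasoning.Setoid ℚᵘ.≃-setoid

/-+-/ : ∀ a b c d .{{_ : NonZero b}} .{{_ : NonZero d}} →
        let instance bd≢0 = m*n≢0 b d in (+ a / b) + (+ c / d) ≡ + (a ℕ.* d ℕ.+ c ℕ.* b) / (b ℕ.* d)
/-+-/ a (suc b) c (suc d) = ℚ.toℚᵘ-injective (begin
  toℚᵘ ((+ a / suc b) + (+ c / suc d))             ≈⟨ ℚ.toℚᵘ-homo-+ (+ a / suc b) (+ c / suc d) ⟩
  toℚᵘ (+ a / suc b) ℚᵘ.+ toℚᵘ (+ c / suc d)       ≈⟨ ℚᵘ.+-cong (ℚ.toℚᵘ-fromℚᵘ (mkℚᵘ (+ a) b)) (ℚ.toℚᵘ-fromℚᵘ (mkℚᵘ (+ c) d)) ⟩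
  mkℚᵘ (+ a) b ℚᵘ.+ mkℚᵘ (+ c) d                   ≈⟨ *≡* (cong (ℤ._* + (suc b ℕ.* suc d)) num) ⟩
  mkℚᵘ (+ (a ℕ.* suc d ℕ.+ c ℕ.* suc b)) _         ≈⟨ ℚ.toℚᵘ-fromℚᵘ (mkℚᵘ (+ (a ℕ.* suc d ℕ.+ c ℕ.* suc b)) (d ℕ.+ b ℕ.* suc d)) ⟨
  toℚᵘ (+ (a ℕ.* suc d ℕ.+ c ℕ.* suc b) / (suc b ℕ.* suc d)) ∎)
  where
  open import Relation.Binary.Reasoning.Setoid ℚᵘ.≃-setoid
  num : + a ℤ.* + suc d ℤ.+ + c ℤ.* + suc b ≡ + (a ℕ.* suc d ℕ.+ c ℕ.* suc b)
  num = sym (trans (ℤ.pos-+ (a ℕ.* suc d) (c ℕ.* suc b)) (cong₂ ℤ._+_ (ℤ.pos-* a (suc d)) (ℤ.pos-* c (suc b))))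

difference : ∀ {x y z} → x + y ≡ z → z - y ≡ x
difference {x} {y} refl = trans (ℚ.+-assoc x y (- y)) (trans (cong (λ z → x + z) (ℚ.+-inverseʳ y)) (ℚ.+-identityʳ x))

-- Writing the denominator as 4 + r makes the numerator of the difference a natural number, so that
-- comparisons take place in ℕ.
1-4/k : ∀ r → 1ℚ - + 4 / (4 ℕ.+ r) ≡ + r / (4 ℕ.+ r)
1-4/k r = difference (trans (/-+-/ r k 4 k) (/-≡ {r ℕ.* k ℕ.+ 4 ℕ.* k} {k ℕ.* k} {1} {1} (arith r)))
  where
  k : ℕ
  k = 4 ℕ.+ r
  arith : ∀ r → (r ℕ.* (4 ℕ.+ r) ℕ.+ 4 ℕ.* (4 ℕ.+ r)) ℕ.* 1 ≡ 1 ℕ.* ((4 ℕ.+ r) ℕ.* (4 ℕ.+ r))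
  arith = solve-∀

½-2/k : ∀ r → ½ - + 2 / (4 ℕ.+ r) ≡ + r / (2 ℕ.* (4 ℕ.+ r))
½-2/k r = difference (trans (/-+-/ r (2 ℕ.* k) 2 k)
  (/-≡ {r ℕ.* k ℕ.+ 2 ℕ.* (2 ℕ.* k)} {2 ℕ.* k ℕ.* k} {1} {2} (arith r)))
  where
  k : ℕ
  k = 4 ℕ.+ r
  arith : ∀ r → (r ℕ.* (4 ℕ.+ r) ℕ.+ 2 ℕ.* (2 ℕ.* (4 ℕ.+ r))) ℕ.* 2 ≡ 1 ℕ.* (2 ℕ.* (4 ℕ.+ r) ℕ.* (4 ℕ.+ r))
  arith = solve-∀

-- The three bounds are e, M and s multiplied by the same fraction r/(2k), so the chain reduces to e
-- ≤ M ≤ s.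
bound-chain : ∀ k r .{{_ : NonZero k}} → k ≡ 4 ℕ.+ r →
  ∀ dist e M s → 2 ℕ.* k ℕ.* dist ℕ.≤ e ℕ.* r → e ℕ.≤ M → M ℕ.≤ s →
  (+ dist / 1 ≤ (+ e / 2) * (1ℚ - + 4 / k))
  × ((+ e / 2) * (1ℚ - + 4 / k) ≤ (+ M / 1) * (½ - + 2 / k))
  × ((+ M / 1) * (½ - + 2 / k) ≤ (+ s / 2) * (1ℚ - + 4 / k))
bound-chain k r refl dist e M s dist≤ e≤M M≤s =
  subst (+ dist / 1 ≤_) (sym (scaled e))
    (/-mono-≤ {dist} {1} {e ℕ.* r} {2 ℕ.* k}
      (subst₂ ℕ._≤_ (ℕ.*-comm (2 ℕ.* k) dist) (sym (ℕ.*-identityʳ (e ℕ.* r))) dist≤)) ,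
  subst₂ _≤_ (sym (scaled e)) (sym middle) (/-mono-≤ {e ℕ.* r} {2 ℕ.* k} {M ℕ.* r} {2 ℕ.* k} (mono e≤M)) ,
  subst₂ _≤_ (sym middle) (sym (scaled s)) (/-mono-≤ {M ℕ.* r} {2 ℕ.* k} {s ℕ.* r} {2 ℕ.* k} (mono M≤s))
  where
  scaled : ∀ x → (+ x / 2) * (1ℚ - + 4 / k) ≡ + (x ℕ.* r) / (2 ℕ.* k)
  scaled x = trans (cong (λ z → + x / 2 * z) (1-4/k r)) (/-*-/ x 2 r k)
  middle : (+ M / 1) * (½ - + 2 / k) ≡ + (M ℕ.* r) / (2 ℕ.* k)
  middle = trans (cong (λ z → + M / 1 * z) (½-2/k r)) (trans (/-*-/ M 1 r (2 ℕ.* k))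
    (/-≡ {M ℕ.* r} {1 ℕ.* (2 ℕ.* k)} {M ℕ.* r} {2 ℕ.* k} (cong (M ℕ.* r ℕ.*_) (sym (ℕ.*-identityˡ (2 ℕ.* k))))))
  mono : ∀ {x y} → x ℕ.≤ y → x ℕ.* r ℕ.* (2 ℕ.* k) ℕ.≤ y ℕ.* r ℕ.* (2 ℕ.* k)
  mono x≤y = ℕ.*-monoˡ-≤ (2 ℕ.* k) (ℕ.*-monoˡ-≤ r x≤y)

-- This yields 4 ≤ 3n, so that 1 - 4/(3n) is not negative.
degree-sequence⇒2≤n : ∀ n .{{_ : NonZero n}} (d : Vec ℕ n) → IsDegreeSequence d → 2 ℕ.≤ n
degree-sequence⇒2≤n zero _ _ = ⊥-elim (ℕ.≢-nonZero⁻¹ 0 refl)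
degree-sequence⇒2≤n (suc zero) _ (pos , G , realizes) = ⊥-elim (ℕ.<⇒≢ (pos zero)
  (trans (sym isolated) (realizes zero)))
  where
  isolated : degree G zero ≡ 0
  isolated = trans (card-tabulate (Graph.adj G zero)) (cong (λ b → ⟦ b ⟧ ℕ.+ 0) (Graph.adj-irrefl G zero))
degree-sequence⇒2≤n (suc (suc n)) _ _ = s≤s (s≤s z≤n)

short-sequence : ∀ {n} .{{_ : NonZero n}} (G H : Graph n) → (∀ v → degree G v ≡ degree H v) →
  ∃[ k ] (SwapSequence k G H × 12 ℕ.* n ℕ.* k ℕ.+ 4 ℕ.* diffCount G H ℕ.≤ 3 ℕ.* n ℕ.* diffCount G H)
short-sequence {n} G H deg = forget (decidable-stable (ℕ.anyUpTo? good? (suc E))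
  (λ ¬found → swaps-bound (suc E) (oriented true G H) ℕ.≤-refl deg
    (λ { (k , seq , le) → ¬found (k , s≤s (k≤E k le) , seq , le) })))
  where
  E : ℕ
  E = diffCount G H
  Good : ℕ → Set
  Good k = SwapSequence k G H × 12 ℕ.* n ℕ.* k ℕ.+ 4 ℕ.* E ℕ.≤ 3 ℕ.* n ℕ.* E
  good? : ∀ k → Dec (Good k)
  good? k = swapSequence? k G H ×-dec (_ ℕ.≤? _)
  forget : ∃[ k ] (k ℕ.< suc E × Good k) → ∃[ k ] Good k
  forget (k , _ , good) = k , good
  k≤E : ∀ k → 12 ℕ.* n ℕ.* k ℕ.+ 4 ℕ.* E ℕ.≤ 3 ℕ.* n ℕ.* E → k ℕ.≤ E
  k≤E k le = ℕ.*-cancelˡ-≤ (3 ℕ.* n) {{m*n≢0 3 n}} (ℕ.≤-trans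
    (ℕ.*-monoˡ-≤ k (ℕ.*-monoˡ-≤ n (ℕ.m≤m+n 3 9))) (ℕ.≤-trans (ℕ.m≤m+n _ (4 ℕ.* E)) le))

theorem3p8 : (n : ℕ) .{{_ : NonZero n}} (d : Vec ℕ n) → IsDegreeSequence d →
    (G₁ G₂ : Graph n) → Realizes G₁ d → Realizes G₂ d →
    let instance 3n≢0 = m*n≢0 3 n in
    ∃[ dist ] IsSwapDistance G₁ G₂ dist
    × (+ dist / 1 ≤ H′ G₁ G₂ * (1ℚ - + 4 / (3 ℕ.* n)))
    × (H′ G₁ G₂ * (1ℚ - + 4 / (3 ℕ.* n)) ≤ m* d * (½ - + 2 / (3 ℕ.* n)))
    × (m* d * (½ - + 2 / (3 ℕ.* n)) ≤ m d * (1ℚ - + 4 / (3 ℕ.* n)))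
theorem3p8 n d deg G₁ G₂ r₁ r₂ =
  conclude (short-sequence G₁ G₂ (λ v → trans (r₁ v) (sym (r₂ v))))
  where
  instance
    3n≢0 : NonZero (3 ℕ.* n)
    3n≢0 = m*n≢0 3 n
  e r : ℕ
  e = length (symDiff G₁ G₂)
  r = 3 ℕ.* n ℕ.∸ 4
  4≤3n : 4 ℕ.≤ 3 ℕ.* n
  4≤3n = ℕ.≤-trans (ℕ.m≤m+n 4 2) (ℕ.*-monoʳ-≤ 3 (degree-sequence⇒2≤n n d deg))
  3n≡4+r : 3 ℕ.* n ≡ 4 ℕ.+ r
  3n≡4+r = sym (ℕ.m+[n∸m]≡n 4≤3n)
  scale : ∀ k → 12 ℕ.* n ℕ.* k ℕ.+ 4 ℕ.* diffCount G₁ G₂ ℕ.≤ 3 ℕ.* n ℕ.* diffCount G₁ G₂ →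
          2 ℕ.* (3 ℕ.* n) ℕ.* k ℕ.≤ e ℕ.* r
  scale k le rewrite sym (handshake G₁ G₂) = ℕ.*-cancelˡ-≤ 2 (ℕ.+-cancelʳ-≤ (4 ℕ.* (2 ℕ.* e)) _ _ (begin
    2 ℕ.* (2 ℕ.* (3 ℕ.* n) ℕ.* k) ℕ.+ 4 ℕ.* (2 ℕ.* e)   ≡⟨ arith₁ n k e ⟩
    12 ℕ.* n ℕ.* k ℕ.+ 4 ℕ.* (2 ℕ.* e)                  ≤⟨ le ⟩
    3 ℕ.* n ℕ.* (2 ℕ.* e)                               ≡⟨ cong (ℕ._* (2 ℕ.* e)) 3n≡4+r ⟩
    (4 ℕ.+ r) ℕ.* (2 ℕ.* e)                             ≡⟨ arith₂ r e ⟩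
    2 ℕ.* (e ℕ.* r) ℕ.+ 4 ℕ.* (2 ℕ.* e)                 ∎))
    where
    open ℕ.≤-Reasoning
    arith₁ : ∀ n k e → 2 ℕ.* (2 ℕ.* (3 ℕ.* n) ℕ.* k) ℕ.+ 4 ℕ.* (2 ℕ.* e) ≡ 12 ℕ.* n ℕ.* k ℕ.+ 4 ℕ.* (2 ℕ.* e)
    arith₁ = solve-∀
    arith₂ : ∀ r e → (4 ℕ.+ r) ℕ.* (2 ℕ.* e) ≡ 2 ℕ.* (e ℕ.* r) ℕ.+ 4 ℕ.* (2 ℕ.* e)
    arith₂ = solve-∀
  conclude : ∃[ k ] (SwapSequence k G₁ G₂ × 12 ℕ.* n ℕ.* k ℕ.+ 4 ℕ.* diffCount G₁ G₂ ℕ.≤ 3 ℕ.* n ℕ.* diffCount G₁ G₂) →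
    ∃[ dist ] IsSwapDistance G₁ G₂ dist
    × (+ dist / 1 ≤ H′ G₁ G₂ * (1ℚ - + 4 / (3 ℕ.* n)))
    × (H′ G₁ G₂ * (1ℚ - + 4 / (3 ℕ.* n)) ≤ m* d * (½ - + 2 / (3 ℕ.* n)))
    × (m* d * (½ - + 2 / (3 ℕ.* n)) ≤ m d * (1ℚ - + 4 / (3 ℕ.* n)))
  conclude (k , seq , le)
    with dist , seq′ , minimum ← least (λ j → swapSequence? j G₁ G₂) k seq =
    dist , (seq′ , minimum) ,
    bound-chain (3 ℕ.* n) r 3n≡4+r dist e _ _
      (ℕ.≤-trans (ℕ.*-monoʳ-≤ (2 ℕ.* (3 ℕ.* n)) (minimum k seq)) (scale k le))
      (symDiff≤ d G₁ G₂ r₁ r₂)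
      (sum-map≤ (λ dᵢ → dᵢ ℕ.⊓ (n ℕ.∸ dᵢ)) (λ dᵢ → ℕ.m⊓n≤m dᵢ (n ℕ.∸ dᵢ)) d)
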